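{- Let $\ell$ be a positive integer. For any non-negative integer $n$, $$v(\Pi_n)=\left(\prod_{i=2}^n\left(c_i^{i-1}\prod_{j=1}^{\lfloor(i-1)/\ell\rfloor}b_{0,-j}\right)\right)\left(\prod_{s=1}^{n}\prod_{t=0}^{s-1}\sum_{i=0}^\ell b_{i,t}c_{s}^{\ell-i}\right).$$
   Context: A path is a finite word over a finite set of steps (integer vectors) together with an initial point in $\mathbb{Z}^2$; it goes from its initial point to its final point. An $\ell$-Schröder path is a path in the $x$-$y$ plane with steps $\mathsf{a}_i=(i,\ell-i)$ for $i=0,\ldots,\ell$ and $\mathsf{a}_{\ell+1}=(1,-1)$, never going below the $x$-axis. Let $b_{i,j}$ ($0\le i\le\ell$, $j\in\mathbb{Z}$) and $c_j$ ($j\in\mathbb{Z}$) be indeterminates. The weight $v$ of the step $\mathsf{a}_i$ ($0\le i\le \ell$) starting at $(x,y)$ is $b_{i,j}$, and the weight of $\mathsf{a}_{\ell+1}$ starting at $(x,y)$ is $c_j$, where $j=(x+y)/\ell$ (an integer for all the paths considered). The weight $v(\omega)$ of a path $\omega$ is the product of the weights of its steps. A path system of size $n$ from $\mathbf{s}=(s_0,\ldots,s_{n-1})$ to $\mathbf{t}=(t_0,\ldots,t_{n-1})$ (tuples of points of $\mathbb{Z}^2$) is a tuple $\boldsymbol{\omega}=(\omega_0,\ldots,\omega_{n-1})$ of paths such that $\omega_i$ goes from $s_i$ to $t_{\sigma(i)}$ for all $i$, for some permutation $\sigma$ of $\{0,\ldots,n-1\}$. It is non-intersecting if the paths are pairwise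 disjoint, i.e. no steps of two different paths share a starting or ending point (the drawn line segments may cross). Its weight is $v(\boldsymbol{\omega})=\operatorname{sign}(\sigma)\,v(\omega_0)\cdots v(\omega_{n-1})$. $\Pi_n$ is the set of non-intersecting path systems of $n$ $\ell$-Schröder paths from $\mathbf{s}=((-i,\,i\bmod\ell))_{i=0,\ldots,n-1}$ to $\mathbf{t}=(((i+1)\ell,0))_{i=0,\ldots,n-1}$, where $i\bmod \ell$ is the remainder of dividing $i$ by $\ell$. Put $v(\Pi_n)=\sum_{\boldsymbol{\omega}\in\Pi_n}v(\boldsymbol{\omega})$ (with $v(\Pi_0)=1$). -}

module Defs where

open import Algebra.Bundles using (CommutativeRing; Semiring)
open import Data.Fin.Base as Fin using (Fin; toℕ)
import Data.Fin.Properties as Fin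
open import Data.Integer.Base as ℤ using (ℤ; +_; -_; 0ℤ; 1ℤ; -1ℤ; _/ℕ_)
import Data.Integer.Properties as ℤ
open import Data.Integer.Tactic.RingSolver using (solve-∀)
open import Data.List.Base
  using (List; []; _∷_; length; map; foldr; filter; deduplicate; allFin;
         concatMap; cartesianProduct; cartesianProductWith)
open import Data.List.Membership.Propositional using (_∈_)
open import Data.List.Membership.Propositional.Properties
  using (∈-map⁺; ∈-allFin; ∈-filter⁺; ∈-filter⁻; ∈-deduplicate⁺;
         ∈-cartesianProduct⁺; ∈-cartesianProductWith⁺; ∈-concatMap⁺)
import Data.List.Properties as List
open import Data.List.Relation.Binary.Disjoint.Propositional using (Disjoint)
import Data.List.Relation.Binary.Disjoint.DecPropositional as Disjoint
open import Data.List.Relation.Unary.All using (All; all?)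
open import Data.List.Relation.Unary.Any using (here; there)
import Data.List.Relation.Unary.Any as Any
open import Data.List.Relation.Unary.Unique.Propositional using (Unique)
import Data.List.Relation.Unary.Unique.Propositional.Properties as Unique
import Data.List.Relation.Unary.Unique.DecPropositional.Properties as DecUnique
open import Data.Nat.Base as ℕ using (ℕ; zero; suc; NonZero; _%_; z≤n; s≤s)
import Data.Nat.Properties as ℕ
open import Data.Product.Base using (_×_; _,_; Σ-syntax; proj₁; proj₂)
import Data.Product.Properties as Product
open import Data.Vec.Base using (Vec; []; _∷_; lookup; count)
import Data.Vec.Properties as Vec
open import Function.Base using (_∘_)
open import Function.Bundles using (_⇔_; mk⇔)
open import Function.Definitions using (Injective; Surjective; Bijective)
open import Relation.Binary.Definitions using (DecidableEquality)
open import Relation.Binary.PropositionalEquality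
  using (_≡_; _≢_; refl; sym; cong; cong₂; subst)
open import Relation.Nullary.Decidable
  using (Dec; yes; no; map′; _×-dec_; _→-dec_; ¬?)
open import Relation.Unary using (Decidable)

Point : Set
Point = ℤ × ℤ

infixl 6 _⊕_
_⊕_ : Point → Point → Point
(x , y) ⊕ (x′ , y′) = (x ℤ.+ x′ , y ℤ.+ y′)

-- `a i` is the step (i , ℓ - i) for 0 ≤ i ≤ ℓ, and `down` is a_{ℓ+1} = (1 , -1).
data Step (ℓ : ℕ) : Set where
  a    : Fin (suc ℓ) → Step ℓ
  down : Step ℓ

vector : ∀ {ℓ} → Step ℓ → Point
vector {ℓ} (a i) = (+ toℕ i , + ℓ ℤ.- + toℕ i)
vector     down  = (1ℤ , -1ℤ)

record Path (ℓ : ℕ) : Set where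
  constructor path
  field
    initial : Point
    word    : List (Step ℓ)

open Path public

endpoint : ∀ {ℓ} → Point → List (Step ℓ) → Point
endpoint p []      = p
endpoint p (u ∷ w) = endpoint (p ⊕ vector u) w

final : ∀ {ℓ} → Path ℓ → Point
final (path p w) = endpoint p w

verticesFrom : ∀ {ℓ} → Point → List (Step ℓ) → List Point
verticesFrom p []      = p ∷ []
verticesFrom p (u ∷ w) = p ∷ verticesFrom (p ⊕ vector u) w

-- The starting and ending points of all the steps (and the initial point, should
-- the path have no step).
vertices : ∀ {ℓ} → Path ℓ → List Point
vertices (path p w) = verticesFrom p w

-- Steps are straight segments, so it suffices to look at the vertices.
IsSchröder : ∀ {ℓ} → Path ℓ → Set
IsSchröder ω = All (λ (_ , y) → 0ℤ ℤ.≤ y) (vertices ω)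

-- The permutation σ is stored as the vector of its values.  When the target
-- points are distinct, as they are below, it is determined by the paths.
record PathSystem (ℓ n : ℕ) : Set where
  constructor system
  field
    paths : Vec (Path ℓ) n
    perm  : Vec (Fin n) n

  ω : Fin n → Path ℓ
  ω = lookup paths

  σ : Fin n → Fin n
  σ = lookup perm

open PathSystem public using (paths; perm)

IsPathSystem : ∀ {ℓ n} (s t : Fin n → Point) → PathSystem ℓ n → Set
IsPathSystem s t Ω =
  Bijective _≡_ _≡_ σ × (∀ i → initial (ω i) ≡ s i × final (ω i) ≡ t (σ i))
  where open PathSystem Ω

NonIntersecting : ∀ {ℓ n} → PathSystem ℓ n → Set
NonIntersecting Ω = ∀ i k → i ≢ k → Disjoint (vertices (ω i)) (vertices (ω k))
  where open PathSystem Ω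

module _ (ℓ : ℕ) .{{_ : NonZero ℓ}} (n : ℕ) where

  source target : Fin n → Point
  source i = (- (+ toℕ i) , + (toℕ i % ℓ))
  target i = (+ (suc (toℕ i) ℕ.* ℓ) , 0ℤ)

  _∈Π : PathSystem ℓ n → Set
  Ω ∈Π = IsPathSystem source target Ω
       × (∀ i → IsSchröder (PathSystem.ω Ω i))
       × NonIntersecting Ω

Finite : {A : Set} → (A → Set) → Set
Finite {A} P = Σ[ xs ∈ List A ] Unique xs × (∀ x → x ∈ xs ⇔ P x)

private
  finite : {A : Set} {P : A → Set} → DecidableEquality A → Decidable P →
           (xs : List A) → (∀ x → P x → x ∈ xs) → Finite P
  finite _≟_ P? xs complete =
    filter P? (deduplicate _≟_ xs) ,
    Unique.filter⁺ P? (DecUnique.deduplicate-! _≟_ xs) ,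
    λ x → mk⇔ (proj₂ ∘ ∈-filter⁻ P? {xs = deduplicate _≟_ xs})
              (λ Px → ∈-filter⁺ P? (∈-deduplicate⁺ _≟_ (complete x Px)) Px)

  _≟ₚ_ : DecidableEquality Point
  _≟ₚ_ = Product.≡-dec ℤ._≟_ ℤ._≟_

  _≟ₛ_ : ∀ {ℓ} → DecidableEquality (Step ℓ)
  a i  ≟ₛ a k  = map′ (cong a) (λ { refl → refl }) (i Fin.≟ k)
  a i  ≟ₛ down = no λ ()
  down ≟ₛ a k  = no λ ()
  down ≟ₛ down = yes refl

  _≟ₚₐ_ : ∀ {ℓ} → DecidableEquality (Path ℓ)
  path p w ≟ₚₐ path q v =
    map′ (λ (e , f) → cong₂ path e f) (λ { refl → refl , refl })
         (p ≟ₚ q ×-dec List.≡-dec _≟ₛ_ w v)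

  _≟ₛᵧ_ : ∀ {ℓ n} → DecidableEquality (PathSystem ℓ n)
  system ω σ ≟ₛᵧ system ω′ σ′ =
    map′ (λ (e , f) → cong₂ system e f) (λ { refl → refl , refl })
         (Vec.≡-dec _≟ₚₐ_ ω ω′ ×-dec Vec.≡-dec Fin._≟_ σ σ′)

  bijective? : ∀ {n} (f : Fin n → Fin n) → Dec (Bijective _≡_ _≡_ f)
  bijective? f = injective? ×-dec surjective?
    where
    injective? : Dec (Injective _≡_ _≡_ f)
    injective? =
      map′ (λ inj {x} {y} → inj x y) (λ inj x y → inj)
           (Fin.all? λ x → Fin.all? λ y → (f x Fin.≟ f y) →-dec (x Fin.≟ y))

    surjective? : Dec (Surjective _≡_ _≡_ f)
    surjective? =
      map′ (λ sur y → proj₁ (sur y) , λ { refl → proj₂ (sur y) })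
           (λ sur y → proj₁ (sur y) , proj₂ (sur y) refl)
           (Fin.all? λ y → Fin.any? λ x → f x Fin.≟ y)

  ∈Π? : ∀ ℓ .{{_ : NonZero ℓ}} n → Decidable (_∈Π ℓ n)
  ∈Π? ℓ n Ω =
    (bijective? σ ×-dec
      Fin.all? λ i → (initial (ω i) ≟ₚ source ℓ n i) ×-dec
                     (final (ω i) ≟ₚ target ℓ n (σ i)))
    ×-dec (Fin.all? λ i → all? (λ (_ , y) → 0ℤ ℤ.≤? y) (vertices (ω i)))
    ×-dec (Fin.all? λ i → Fin.all? λ k → ¬? (i Fin.≟ k) →-dec
             Disjoint.disjoint? _≟ₚ_ (vertices (ω i)) (vertices (ω k)))
    where open PathSystem Ω

  -- Every step increases 2x + y, so the length of a path is bounded in terms of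
  -- its initial and final points.

  height : Point → ℤ
  height (x , y) = x ℤ.+ (x ℤ.+ y)

  height-vector : ∀ {ℓ} .{{_ : NonZero ℓ}} (u : Step ℓ) → 1ℤ ℤ.≤ height (vector u)
  height-vector {ℓ} (a i) = subst (1ℤ ℤ.≤_) (sym (eq (+ toℕ i) (+ ℓ)))
    (ℤ.+≤+ (ℕ.≤-trans (ℕ.>-nonZero⁻¹ ℓ) (ℕ.m≤n+m ℓ (toℕ i))))
    where
    eq : ∀ x l → x ℤ.+ (x ℤ.+ (l ℤ.- x)) ≡ x ℤ.+ l
    eq = solve-∀
  height-vector down = ℤ.≤-refl

  height-⊕ : ∀ p q → height (p ⊕ q) ≡ height p ℤ.+ height q
  height-⊕ (x , y) (x′ , y′) = eq x y x′ y′
    where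
    eq : ∀ x y x′ y′ → (x ℤ.+ x′) ℤ.+ ((x ℤ.+ x′) ℤ.+ (y ℤ.+ y′))
                     ≡ (x ℤ.+ (x ℤ.+ y)) ℤ.+ (x′ ℤ.+ (x′ ℤ.+ y′))
    eq = solve-∀

  height-endpoint : ∀ {ℓ} .{{_ : NonZero ℓ}} p (w : List (Step ℓ)) →
                    + length w ℤ.+ height p ℤ.≤ height (endpoint p w)
  height-endpoint p []      = ℤ.≤-reflexive (ℤ.+-identityˡ (height p))
  height-endpoint p (u ∷ w) = begin
    + suc (length w) ℤ.+ height p                    ≡⟨ eq (+ length w) (height p) ⟩
    + length w ℤ.+ (height p ℤ.+ 1ℤ)                 ≤⟨ ℤ.+-monoʳ-≤ (+ length w) (ℤ.+-monoʳ-≤ (height p) (height-vector u)) ⟩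
    + length w ℤ.+ (height p ℤ.+ height (vector u))  ≡⟨ cong (λ h → + length w ℤ.+ h) (height-⊕ p (vector u)) ⟨
    + length w ℤ.+ height (p ⊕ vector u)             ≤⟨ height-endpoint (p ⊕ vector u) w ⟩
    height (endpoint (p ⊕ vector u) w)               ∎
    where
    open ℤ.≤-Reasoning
    eq : ∀ k h → (1ℤ ℤ.+ k) ℤ.+ h ≡ k ℤ.+ (h ℤ.+ 1ℤ)
    eq = solve-∀

  maxLength : Point → Point → ℕ
  maxLength p q = ℤ.∣ height q ℤ.- height p ∣

  length≤ : ∀ {ℓ} .{{_ : NonZero ℓ}} p (w : List (Step ℓ)) →
            length w ℕ.≤ maxLength p (endpoint p w)
  length≤ p w = ℤ.drop‿+≤+ (ℤ.≤-trans bound (ℤ.≤-reflexive (sym abs)))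
    where
    eq : ∀ k h → (k ℤ.+ h) ℤ.- h ≡ k
    eq = solve-∀

    bound : + length w ℤ.≤ height (endpoint p w) ℤ.- height p
    bound = subst (ℤ._≤ height (endpoint p w) ℤ.- height p) (eq (+ length w) (height p))
                  (ℤ.+-monoˡ-≤ (- height p) (height-endpoint p w))

    abs : + maxLength p (endpoint p w) ≡ height (endpoint p w) ℤ.- height p
    abs = ℤ.0≤i⇒+∣i∣≡i (ℤ.≤-trans (ℤ.+≤+ z≤n) bound)

  steps : ∀ ℓ → List (Step ℓ)
  steps ℓ = down ∷ map a (allFin (suc ℓ))

  ∈-steps : ∀ {ℓ} (u : Step ℓ) → u ∈ steps ℓ
  ∈-steps (a i) = there (∈-map⁺ a (∈-allFin i))
  ∈-steps down  = here refl

  words : ∀ ℓ → ℕ → List (List (Step ℓ))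
  words ℓ zero    = [] ∷ []
  words ℓ (suc N) = [] ∷ cartesianProductWith _∷_ (steps ℓ) (words ℓ N)

  ∈-words : ∀ {ℓ N} (w : List (Step ℓ)) → length w ℕ.≤ N → w ∈ words ℓ N
  ∈-words {N = zero}  []      _       = here refl
  ∈-words {N = suc N} []      _       = here refl
  ∈-words {N = suc N} (u ∷ w) (s≤s l) =
    there (∈-cartesianProductWith⁺ _∷_ (∈-steps u) (∈-words w l))

  vecs : {A : Set} → List A → ∀ n → List (Vec A n)
  vecs xs zero    = [] ∷ []
  vecs xs (suc n) = cartesianProductWith _∷_ xs (vecs xs n)

  ∈-vecs : ∀ {A : Set} {xs : List A} {n} (v : Vec A n) →
           (∀ i → lookup v i ∈ xs) → v ∈ vecs xs n
  ∈-vecs []      _  = here refl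
  ∈-vecs (x ∷ v) x∈ =
    ∈-cartesianProductWith⁺ _∷_ (x∈ Fin.zero) (∈-vecs v (x∈ ∘ Fin.suc))

  module _ (ℓ : ℕ) .{{_ : NonZero ℓ}} (n : ℕ) where

    pathsBetween : Fin n × Fin n → List (Path ℓ)
    pathsBetween (i , k) = map (path p) (words ℓ (maxLength p q))
      where
      p = source ℓ n i
      q = target ℓ n k

    candidatePaths : List (Path ℓ)
    candidatePaths = concatMap pathsBetween (cartesianProduct (allFin n) (allFin n))

    ∈-candidatePaths : ∀ (π : Path ℓ) i k → initial π ≡ source ℓ n i →
                       final π ≡ target ℓ n k → π ∈ candidatePaths
    ∈-candidatePaths (path p w) i k refl e =
      ∈-concatMap⁺ pathsBetween
        (Any.map (λ { refl → ∈-map⁺ (path p) (∈-words w bound) })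
                 (∈-cartesianProduct⁺ (∈-allFin i) (∈-allFin k)))
      where
      bound : length w ℕ.≤ maxLength p (target ℓ n k)
      bound = subst (λ q → length w ℕ.≤ maxLength p q) e (length≤ p w)

    candidates : List (PathSystem ℓ n)
    candidates = cartesianProductWith system (vecs candidatePaths n) (vecs (allFin n) n)

    ∈-candidates : ∀ Ω → _∈Π ℓ n Ω → Ω ∈ candidates
    ∈-candidates Ω ((_ , ends) , _) =
      ∈-cartesianProductWith⁺ system
        (∈-vecs (paths Ω) λ i →
          ∈-candidatePaths (ω i) i (σ i) (proj₁ (ends i)) (proj₂ (ends i)))
        (∈-vecs (perm Ω) λ i → ∈-allFin (σ i))
      where open PathSystem Ω

Π-finite : ∀ ℓ .{{_ : NonZero ℓ}} n → Finite (_∈Π ℓ n)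
Π-finite ℓ n = finite _≟ₛᵧ_ (∈Π? ℓ n) (candidates ℓ n) (∈-candidates ℓ n)

Π : ∀ ℓ .{{_ : NonZero ℓ}} n → List (PathSystem ℓ n)
Π ℓ n = proj₁ (Π-finite ℓ n)

inversions : ∀ {m n} → Vec (Fin n) m → ℕ
inversions []      = 0
inversions (i ∷ v) = count (Fin._<? i) v ℕ.+ inversions v

module RingNotation {r e} (R : CommutativeRing r e) where

  open CommutativeRing R public using (Carrier; _≈_; _+_; _*_; 0#; 1#)
  open import Algebra.Definitions.RawSemiring (Semiring.rawSemiring (CommutativeRing.semiring R)) public
    using (_^_; sum; product)

  ∏ : ℕ → ℕ → (ℕ → Carrier) → Carrier
  ∏ lo hi f = product {suc hi ℕ.∸ lo} λ k → f (lo ℕ.+ toℕ k)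

  infix 5 ∏
  syntax ∏ lo hi (λ i → e) = ∏[ i ∈ lo ⋯ hi ] e

  ∑ : ∀ n → (Fin (suc n) → Carrier) → Carrier
  ∑ n = sum

  infix 5 ∑
  syntax ∑ n (λ i → e) = ∑[ i ≤ n ] e

-- The indeterminates are rendered as arbitrary families b and c of elements of
-- an arbitrary commutative ring, so that an identity between weights amounts to
-- one in the polynomial ring over ℤ in these indeterminates.
module Weight {r e} (R : CommutativeRing r e) (ℓ : ℕ) .{{_ : NonZero ℓ}}
              (b : Fin (suc ℓ) → ℤ → CommutativeRing.Carrier R)
              (c : ℤ → CommutativeRing.Carrier R) where

  open CommutativeRing R using () renaming (-_ to -ᴿ_)
  open RingNotation R

  -- The division is exact along any path starting on a point with ℓ ∣ x + y.
  stepWeight : Point → Step ℓ → Carrier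
  stepWeight (x , y) (a i) = b i ((x ℤ.+ y) /ℕ ℓ)
  stepWeight (x , y) down  = c ((x ℤ.+ y) /ℕ ℓ)

  wordWeight : Point → List (Step ℓ) → Carrier
  wordWeight p []      = 1#
  wordWeight p (u ∷ w) = stepWeight p u * wordWeight (p ⊕ vector u) w

  pathWeight : Path ℓ → Carrier
  pathWeight (path p w) = wordWeight p w

  sign : ∀ {n} → Vec (Fin n) n → Carrier
  sign σ = (-ᴿ 1#) ^ inversions σ

  systemWeight : ∀ {n} → PathSystem ℓ n → Carrier
  systemWeight Ω = sign (perm Ω) * product (pathWeight ∘ PathSystem.ω Ω)

  v[Π_] : ℕ → Carrier
  v[Π n ] = foldr _+_ 0# (map systemWeight (Π ℓ n))

module Submission where

-- By the Lindström–Gessel–Viennot lemma v(Π_n) is the determinant of the matrix of the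
-- generating functions of the paths from the sources to the targets.  Fix a target k.
-- As a function of the ordinate y at which a path enters the line x + y = jℓ, this
-- generating function is a linear functional on polynomials, applied to z^y.
-- Multiplying by z - c_j turns the functional on line j into z times the one given by
-- the steps a_i alone, and kills it when target k lies on line j.  Hence on the Newton
-- polynomials (z - c_1)⋯(z - c_i) the functionals form a triangular matrix, with diagonal
-- c_{k+1}^k ∏_{t≤k} ∑_i b_{i,t} c_{k+1}^{ℓ-i}.  A path from source i can reach line 0 with
-- highest ordinate i only by the steps a_0, of weight ∏_{j≤⌊i/ℓ⌋} b_{0,-j}; so the rows of
-- the determinant are these multiples of the Newton rows plus lower ones.

open import Defs
open import Algebra.Bundles using (CommutativeRing; Semiring)
open import Data.Bool.Base using (true; false; if_then_else_)
open import Data.Fin.Base as Fin using (Fin; zero; suc; toℕ; fromℕ<)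
import Data.Fin.Properties as Fin
open import Data.Integer.Base as ℤ using (ℤ; +_; -[1+_]; 0ℤ; 1ℤ; _/ℕ_)
import Data.Integer.Properties as ℤ
import Data.Integer.Tactic.RingSolver as ℤ-Solver
open import Data.List.Base as List using (List; []; _∷_; _++_; foldr)
open import Data.List.Membership.Propositional using (_∈_; _∉_)
open import Data.List.Membership.Propositional.Properties
  using (∈-++⁺ˡ; ∈-++⁺ʳ; ∈-++⁻; ∈-map⁺; ∈-map⁻)
open import Data.List.Membership.Propositional.Properties.WithK using (unique∧set⇒bag)
import Data.List.Properties as List
open import Data.List.Relation.Binary.BagAndSetEquality using (∼bag⇒↭)
open import Data.List.Relation.Binary.Disjoint.Propositional using (Disjoint)
open import Data.List.Relation.Binary.Permutation.Propositional using (_↭_; ↭⇒↭ₛ′)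
open import Data.List.Relation.Binary.Permutation.Propositional.Properties
  using () renaming (map⁺ to ↭-map⁺)
open import Data.List.Relation.Unary.All using (All; []; _∷_)
open import Data.List.Relation.Unary.AllPairs using ([]; _∷_)
open import Data.List.Relation.Unary.Any using (here; there)
open import Data.List.Relation.Unary.Unique.Propositional using (Unique)
import Data.List.Relation.Unary.Unique.Propositional.Properties as Unique
open import Data.Nat.Base as ℕ using (ℕ; zero; suc; NonZero; _∸_; _/_; _%_; pred)
open import Data.Nat.DivMod using (m≡m%n+[m/n]*n; m*n/n≡m; m*n%n≡0; 0/n≡0)
open import Data.Nat.Induction using (<-wellFounded)
import Data.Nat.Properties as ℕ
import Data.Nat.Tactic.RingSolver as ℕ-Solver
open import Data.Product.Base using (Σ; _×_; _,_; proj₁; proj₂; ∃-syntax)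
import Data.Product.Properties as Product
open import Data.Sum.Base using (_⊎_; inj₁; inj₂; [_,_]′)
open import Data.Unit.Polymorphic using (⊤; tt)
open import Data.Vec.Base as Vec
  using (Vec; []; _∷_; lookup; map; tabulate; count; replicate; updateAt; _[_]≔_; insertAt; removeAt)
import Data.Vec.Properties as Vec
open import Data.Vec.Relation.Binary.Pointwise.Extensional using (ext; Pointwise-≡⇒≡)
open import Function.Base using (_∘_; id; case_of_)
open import Function.Bundles using (_⇔_; mk⇔; Equivalence)
open import Induction.WellFounded using (Acc; acc)
open import Level using (_⊔_)
open import Relation.Binary.PropositionalEquality as ≡ using (_≡_; _≢_)
open import Relation.Nullary using (¬_; Dec; yes; no; contradiction; does)
open import Relation.Nullary.Decidable using (map′; _×-dec_; ¬?; dec-true; dec-false)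
open import Algebra.Properties.CommutativeSemigroup ℕ.+-commutativeSemigroup
  using () renaming (x∙yz≈y∙xz to +-comm₁₂)
open import Algebra.Properties.AbelianGroup ℤ.+-0-abelianGroup
  using () renaming (∙-cancelˡ to +-cancelˡ)

-- Inversions of a permutation

count-insertAt : ∀ {n m} (v : Vec (Fin n) m) i {j x : Fin n} → j Fin.< x →
                 count (Fin._<? x) (insertAt v i j) ≡ suc (count (Fin._<? x) v)
count-insertAt v       zero {j} {x} j<x rewrite dec-true (j Fin.<? x) j<x = ≡.refl
count-insertAt (y ∷ v) (suc i) {j} {x} j<x with does (y Fin.<? x)
... | true  = ≡.cong suc (count-insertAt v i j<x)
... | false = count-insertAt v i j<x

count-none : ∀ {n m} (v : Vec (Fin n) m) {x : Fin n} → (∀ i → x Fin.< lookup v i) → count (Fin._<? x) v ≡ 0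
count-none []      above = ≡.refl
count-none (y ∷ v) {x} above rewrite dec-false (y Fin.<? x) (ℕ.<-asym (above zero)) =
  count-none v (above ∘ suc)

-- A value below all others forms an inversion with exactly the `toℕ i` entries in front of it. This
-- is also the number of sign changes that `expand` makes before it reaches row `i`.
inversions-insertAt : ∀ {n m} (v : Vec (Fin n) m) i (j : Fin n) → (∀ l → j Fin.< lookup v l) →
                      inversions (insertAt v i j) ≡ toℕ i ℕ.+ inversions v
inversions-insertAt v       zero    j above = ≡.cong (ℕ._+ inversions v) (count-none v above)
inversions-insertAt (x ∷ v) (suc i) j above
  rewrite count-insertAt v i (above zero) | inversions-insertAt v i j (above ∘ suc) =
  ≡.cong suc (+-comm₁₂ (count (Fin._<? x) v) (toℕ i) (inversions v))

-- Determinants as alternating multilinear functions of their rows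

module Determinant {r e} (R : CommutativeRing r e) where
  open CommutativeRing R hiding (zero)
  open import Algebra.Properties.Ring ring using (-‿distribʳ-*; -‿+-comm; -0#≈0#; -1*x≈-x)
  open import Algebra.Properties.CommutativeSemigroup +-commutativeSemigroup
    using () renaming (interchange to +-interchange)
  open import Algebra.Properties.CommutativeSemigroup *-commutativeSemigroup
    using () renaming (x∙yz≈y∙xz to x*yz≈y*xz; interchange to *-interchange)
  open import Algebra.Definitions.RawSemiring (Semiring.rawSemiring semiring) using (sum; product)
  open import Algebra.Properties.Semiring.Exp semiring using (_^_; ^-homo-*)
  open import Algebra.Properties.Monoid.Sum *-monoid using () renaming (sum-cong-≗ to product-cong-≗)
  open import Relation.Binary.Reasoning.Setoid setoid

  -- Rows are infinite, so a minor keeps its rows unchanged and only the range of columns that `det`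
  -- reads becomes shorter.
  Row : Set r
  Row = ℕ → Carrier

  infix 4 _≋_
  _≋_ : Row → Row → Set e
  f ≋ g = ∀ k → f k ≈ g k

  infixl 6 _⊹_
  _⊹_ : Row → Row → Row
  (f ⊹ g) k = f k + g k

  infixr 7 _∙_
  _∙_ : Carrier → Row → Row
  (w ∙ f) k = w * f k

  𝟎 : Row
  𝟎 _ = 0#

  x-0≈x : ∀ {x y} → y ≈ 0# → x - y ≈ x
  x-0≈x {x} y≈0 = trans (+-congˡ (trans (-‿cong y≈0) -0#≈0#)) (+-identityʳ x)

  record Linear (L : Row → Carrier) : Set (r ⊔ e) where
    field
      cong⁺  : ∀ {f g} → f ≋ g → L f ≈ L g
      add    : ∀ f g → L (f ⊹ g) ≈ L f + L g
      scale  : ∀ w f → L (w ∙ f) ≈ w * L f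

    vanish : ∀ {f} → f ≋ 𝟎 → L f ≈ 0#
    vanish {f} f≋𝟎 = begin
      L f         ≈⟨ cong⁺ (λ k → trans (f≋𝟎 k) (sym (zeroˡ 0#))) ⟩
      L (0# ∙ 𝟎)  ≈⟨ scale 0# 𝟎 ⟩
      0# * L 𝟎    ≈⟨ zeroˡ _ ⟩
      0#          ∎

  open Linear

  evaluation-linear : ∀ k w → Linear (λ f → f k * w)
  evaluation-linear k w = record
    { cong⁺ = λ f≋g → *-congʳ (f≋g k)
    ; add   = λ f g → distribʳ w (f k) (g k)
    ; scale = λ v f → *-assoc v (f k) w
    }

  *-linear : ∀ w {L} → Linear L → Linear (λ f → w * L f)
  *-linear w L-lin = record
    { cong⁺ = λ f≋g → *-congˡ (cong⁺ L-lin f≋g)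
    ; add   = λ f g → trans (*-congˡ (add L-lin f g)) (distribˡ w _ _)
    ; scale = λ v f → trans (*-congˡ (scale L-lin v f)) (x*yz≈y*xz w v _)
    }

  minus-linear : ∀ {L L′} → Linear L → Linear L′ → Linear (λ f → L f - L′ f)
  minus-linear L-lin L′-lin = record
    { cong⁺ = λ f≋g → +-cong (cong⁺ L-lin f≋g) (-‿cong (cong⁺ L′-lin f≋g))
    ; add   = λ f g → trans
        (+-cong (add L-lin f g) (trans (-‿cong (add L′-lin f g)) (sym (-‿+-comm _ _))))
        (+-interchange _ _ _ _)
    ; scale = λ v f → trans
        (+-cong (scale L-lin v f) (trans (-‿cong (scale L′-lin v f)) (-‿distribʳ-* v _)))
        (sym (distribˡ v _ _))
    }

  AlternatingHead : ∀ m → (Vec Row (suc m) → Carrier) → Set (r ⊔ e)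
  AlternatingHead zero    D = ⊤
  AlternatingHead (suc m) D = ∀ x xs → D (x ∷ x ∷ xs) ≈ 0#

  -- Equal rows are tested only in two adjacent places, after any prefix has been fixed. This form
  -- is what the recursion of `expand` preserves directly; arbitrary places follow in
  -- `vanish-repeated`.
  data MultiAlternating : ∀ m → (Vec Row m → Carrier) → Set (r ⊔ e) where
    nil  : ∀ {D} → MultiAlternating zero D
    cons : ∀ {m D} → (∀ xs → Linear (λ x → D (x ∷ xs))) →
           (∀ x → MultiAlternating m (D ∘ (x ∷_))) → AlternatingHead m D →
           MultiAlternating (suc m) D

  head-linear : ∀ {m D} → MultiAlternating (suc m) D → ∀ xs → Linear (λ x → D (x ∷ xs))
  head-linear (cons lin _ _) = lin

  tail-alternating : ∀ {m D} → MultiAlternating (suc m) D → ∀ x → MultiAlternating m (D ∘ (x ∷_))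
  tail-alternating (cons _ alt _) = alt

  head-alternating : ∀ {m D} → MultiAlternating (2 ℕ.+ m) D → ∀ x xs → D (x ∷ x ∷ xs) ≈ 0#
  head-alternating (cons _ _ alt) = alt

  slot-linear : ∀ {m D} → MultiAlternating m D → ∀ i xs → Linear (λ x → D (xs [ i ]≔ x))
  slot-linear D-alt zero    (x ∷ xs) = head-linear D-alt xs
  slot-linear D-alt (suc i) (x ∷ xs) = slot-linear (tail-alternating D-alt x) i xs

  -- Polarization: the vanishing value at two rows `x ⊹ y` expands into four terms, two of which
  -- vanish themselves.
  swap-head : ∀ {m D} → MultiAlternating (2 ℕ.+ m) D →
              ∀ x y xs → D (x ∷ y ∷ xs) + D (y ∷ x ∷ xs) ≈ 0#
  swap-head {D = D} D-alt x y xs = begin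
    d x y + d y x                      ≈⟨ +-cong (sym (+-identityˡ _)) (sym (+-identityʳ _)) ⟩
    0# + d x y + (d y x + 0#)          ≈⟨ +-cong (+-congʳ (alt x)) (+-congˡ (alt y)) ⟨
    d x x + d x y + (d y x + d y y)    ≈⟨ +-cong (add (linʳ x) x y) (add (linʳ y) x y) ⟨
    d x (x ⊹ y) + d y (x ⊹ y)          ≈⟨ add (head-linear D-alt _) x y ⟨
    d (x ⊹ y) (x ⊹ y)                  ≈⟨ alt (x ⊹ y) ⟩
    0#                                 ∎
    where
    d : Row → Row → Carrier
    d u v = D (u ∷ v ∷ xs)
    alt : ∀ u → d u u ≈ 0#
    alt u = head-alternating D-alt u xs
    linʳ : ∀ u → Linear (d u)
    linʳ u = head-linear (tail-alternating D-alt u) xs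

  -- Exchanging the first two rows costs a sign and brings the row one place nearer to its copy.
  vanish-head : ∀ {m D} → MultiAlternating (suc m) D → ∀ xs i → D (lookup xs i ∷ xs) ≈ 0#
  vanish-head D-alt (x ∷ xs) zero    = head-alternating D-alt x xs
  vanish-head {D = D} D-alt (x ∷ xs) (suc i) = begin
    D (y ∷ x ∷ xs)                   ≈⟨ +-identityʳ _ ⟨
    D (y ∷ x ∷ xs) + 0#              ≈⟨ +-congˡ (vanish-head (tail-alternating D-alt x) xs i) ⟨
    D (y ∷ x ∷ xs) + D (x ∷ y ∷ xs)  ≈⟨ swap-head D-alt y x xs ⟩
    0#                               ∎
    where
    y : Row
    y = lookup xs i

  vanish-repeated : ∀ {m D} → MultiAlternating m D → ∀ xs {i j} → i ≢ j →
                    lookup xs i ≡ lookup xs j → D xs ≈ 0#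
  vanish-repeated D-alt (x ∷ xs) {zero}  {zero}  i≢j eq = contradiction ≡.refl i≢j
  vanish-repeated D-alt (x ∷ xs) {zero}  {suc j} i≢j ≡.refl = vanish-head D-alt xs j
  vanish-repeated D-alt (x ∷ xs) {suc i} {zero}  i≢j ≡.refl = vanish-head D-alt xs i
  vanish-repeated D-alt (x ∷ xs) {suc i} {suc j} i≢j eq =
    vanish-repeated (tail-alternating D-alt x) xs (i≢j ∘ ≡.cong suc) eq

  -- The Laplace expansion along column k, where D evaluates the minors.
  expand : ∀ {m} → ℕ → (Vec Row m → Carrier) → Vec Row (suc m) → Carrier
  expand {zero}  k D (x ∷ []) = x k * D []
  expand {suc m} k D (x ∷ xs) = x k * D xs - expand k (D ∘ (x ∷_)) xs

  expand-cong : ∀ {m} k {D D′ : Vec Row m → Carrier} → (∀ xs → D xs ≈ D′ xs) →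
                ∀ xs → expand k D xs ≈ expand k D′ xs
  expand-cong {zero}  k D≈D′ (x ∷ []) = *-congˡ (D≈D′ [])
  expand-cong {suc m} k D≈D′ (x ∷ xs) =
    +-cong (*-congˡ (D≈D′ xs)) (-‿cong (expand-cong k (D≈D′ ∘ (x ∷_)) xs))

  expand-zero : ∀ {m} k {D : Vec Row m → Carrier} → (∀ xs → D xs ≈ 0#) → ∀ xs → expand k D xs ≈ 0#
  expand-zero {zero}  k D≈0 (x ∷ []) = trans (*-congˡ (D≈0 [])) (zeroʳ _)
  expand-zero {suc m} k D≈0 (x ∷ xs) =
    trans (x-0≈x (expand-zero k (D≈0 ∘ (x ∷_)) xs)) (trans (*-congˡ (D≈0 xs)) (zeroʳ _))

  expand-zero-column : ∀ {m} k (D : Vec Row m → Carrier) xs → (∀ i → lookup xs i k ≈ 0#) →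
                       expand k D xs ≈ 0#
  expand-zero-column {zero}  k D (x ∷ []) col≈0 = trans (*-congʳ (col≈0 zero)) (zeroˡ _)
  expand-zero-column {suc m} k D (x ∷ xs) col≈0 =
    trans (x-0≈x (expand-zero-column k (D ∘ (x ∷_)) xs (col≈0 ∘ suc)))
          (trans (*-congʳ (col≈0 zero)) (zeroˡ _))

  expand-linear : ∀ {m} k (Φ : Row → Vec Row m → Carrier) → (∀ ys → Linear (λ x → Φ x ys)) →
                  ∀ xs → Linear (λ x → expand k (Φ x) xs)
  expand-linear {zero}  k Φ lin (y ∷ []) = *-linear (y k) (lin [])
  expand-linear {suc m} k Φ lin (y ∷ ys) =
    minus-linear (*-linear (y k) (lin ys)) (expand-linear k (λ x → Φ x ∘ (y ∷_)) (lin ∘ (y ∷_)) ys)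

  *-alternating : ∀ {m D} w → MultiAlternating m D → MultiAlternating m (λ xs → w * D xs)
  *-alternating w nil = nil
  *-alternating {suc m} {D} w (cons lin alt head) =
    cons (λ xs → *-linear w (lin xs)) (λ x → *-alternating w (alt x)) (head′ head)
    where
    head′ : ∀ {m D} → AlternatingHead m D → AlternatingHead m (λ xs → w * D xs)
    head′ {zero}  _ = tt
    head′ {suc m} h = λ x xs → trans (*-congˡ (h x xs)) (zeroʳ w)

  minus-alternating : ∀ {m D D′} → MultiAlternating m D → MultiAlternating m D′ →
                MultiAlternating m (λ xs → D xs - D′ xs)
  minus-alternating nil nil = nil
  minus-alternating (cons lin alt head) (cons lin′ alt′ head′) =
    cons (λ xs → minus-linear (lin xs) (lin′ xs)) (λ x → minus-alternating (alt x) (alt′ x))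
         (minus head head′)
    where
    minus : ∀ {m D D′} → AlternatingHead m D → AlternatingHead m D′ →
            AlternatingHead m (λ xs → D xs - D′ xs)
    minus {zero}  _ _  = tt
    minus {suc m} h h′ = λ x xs → trans (x-0≈x (h′ x xs)) (h x xs)

  -- If the first two rows agree, the first two terms of the expansion cancel, and every further
  -- minor still contains both copies.
  expand-alternating : ∀ {m D} k → MultiAlternating m D → MultiAlternating (suc m) (expand k D)
  expand-alternating {zero}  {D} k D-alt =
    cons (λ { [] → evaluation-linear k (D []) }) (λ _ → nil) tt
  expand-alternating {suc m} {D} k D-alt = cons
    (λ xs → minus-linear (evaluation-linear k (D xs))
                     (expand-linear k (λ x → D ∘ (x ∷_)) (head-linear D-alt) xs))
    (λ x → minus-alternating (*-alternating (x k) D-alt) (expand-alternating k (tail-alternating D-alt x)))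
    (head m D-alt)
    where
    head : ∀ m {D} → MultiAlternating (suc m) D → ∀ x xs → expand k D (x ∷ x ∷ xs) ≈ 0#
    head zero {D} D-alt x []       = -‿inverseʳ _
    head (suc m) {D} D-alt x xs = begin
      x k * D (x ∷ xs) - (x k * D (x ∷ xs) - expand k (λ ys → D (x ∷ x ∷ ys)) xs)
        ≈⟨ +-congˡ (-‿cong (x-0≈x (expand-zero k (head-alternating D-alt x) xs))) ⟩
      x k * D (x ∷ xs) - x k * D (x ∷ xs)  ≈⟨ -‿inverseʳ _ ⟩
      0#                                   ∎

  -- The determinant of the columns k, …, k + m - 1.
  det : ∀ m → ℕ → Vec Row m → Carrier
  det zero    k xs = 1#
  det (suc m) k xs = expand k (det m (suc k)) xs

  det-alternating : ∀ m k → MultiAlternating m (det m k)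
  det-alternating zero    k = nil
  det-alternating (suc m) k = expand-alternating k (det-alternating m (suc k))

  expand-head : ∀ {m} k (D : Vec Row m → Carrier) x xs → (∀ i → lookup xs i k ≈ 0#) →
                expand k D (x ∷ xs) ≈ x k * D xs
  expand-head {zero}  k D x []  col≈0 = refl
  expand-head {suc m} k D x xs  col≈0 = x-0≈x (expand-zero-column k (D ∘ (x ∷_)) xs col≈0)

  rowsFrom : (ℕ → Row) → ℕ → ∀ m → Vec Row m
  rowsFrom F i zero    = []
  rowsFrom F i (suc m) = F i ∷ rowsFrom F (suc i) m

  productFrom : (ℕ → Carrier) → ℕ → ℕ → Carrier
  productFrom β i zero    = 1#
  productFrom β i (suc m) = β i * productFrom β (suc i) m

  -- Below the first row, column `k` is zero, so the expansion along it has a single term.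
  det-upperTriangular : ∀ m k F → (∀ {i j} → j ℕ.< i → i ℕ.< k ℕ.+ m → F i j ≈ 0#) →
                        det m k (rowsFrom F k m) ≈ productFrom (λ i → F i i) k m
  det-upperTriangular zero    k F F≈0 = refl
  det-upperTriangular (suc m) k F F≈0 = trans
    (expand-head k (det m (suc k)) (F k) (rowsFrom F (suc k) m)
      (column m (ℕ.n<1+n k) (≡.sym (ℕ.+-suc k m))))
    (*-congˡ (det-upperTriangular m (suc k) F
      (λ {i} j<i i< → F≈0 j<i (≡.subst (i ℕ.<_) (≡.sym (ℕ.+-suc k m)) i<))))
    where
    column : ∀ m′ {i} → k ℕ.< i → i ℕ.+ m′ ≡ k ℕ.+ suc m → ∀ j → lookup (rowsFrom F i m′) j k ≈ 0#
    column (suc m′) {i} k<i eq zero    = F≈0 k<i (≡.subst (i ℕ.<_) eq (ℕ.m<m+n i ℕ.z<s))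
    column (suc m′) {i} k<i eq (suc j) =
      column m′ (ℕ.m<n⇒m<1+n k<i) (≡.trans (≡.sym (ℕ.+-suc i m′)) eq) j

  rowsFrom-tabulate : ∀ F i m → rowsFrom F i m ≡ tabulate (λ j → F (i ℕ.+ toℕ j))
  rowsFrom-tabulate F i zero    = ≡.refl
  rowsFrom-tabulate F i (suc m) = ≡.cong₂ _∷_ (≡.cong F (≡.sym (ℕ.+-identityʳ i)))
    (≡.trans (rowsFrom-tabulate F (suc i) m)
             (Vec.tabulate-cong λ j → ≡.cong F (≡.sym (ℕ.+-suc i (toℕ j)))))

  productFrom-cong : ∀ {f g} i m → (∀ j → i ℕ.≤ j → j ℕ.< i ℕ.+ m → f j ≈ g j) →
                     productFrom f i m ≈ productFrom g i m
  productFrom-cong i zero    f≈g = refl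
  productFrom-cong i (suc m) f≈g = *-cong (f≈g i ℕ.≤-refl (ℕ.m<m+n i ℕ.z<s))
    (productFrom-cong (suc i) m λ j i<j j< →
      f≈g j (ℕ.<⇒≤ i<j) (≡.subst (j ℕ.<_) (≡.sym (ℕ.+-suc i m)) j<))

  productFrom-* : ∀ f g i m → productFrom f i m * productFrom g i m ≈ productFrom (λ j → f j * g j) i m
  productFrom-* f g i zero    = *-identityˡ 1#
  productFrom-* f g i (suc m) = trans (*-interchange _ _ _ _) (*-congˡ (productFrom-* f g (suc i) m))

  productFrom-one : ∀ i m → productFrom (λ _ → 1#) i m ≈ 1#
  productFrom-one i zero    = refl
  productFrom-one i (suc m) = trans (*-identityˡ _) (productFrom-one (suc i) m)

  productFrom-suc : ∀ f i m → productFrom f (suc i) m ≡ productFrom (f ∘ suc) i m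
  productFrom-suc f i zero    = ≡.refl
  productFrom-suc f i (suc m) = ≡.cong (f (suc i) *_) (productFrom-suc f (suc i) m)

  productFrom-last : ∀ f i m → productFrom f i (suc m) ≈ f (i ℕ.+ m) * productFrom f i m
  productFrom-last f i zero    = *-congʳ (reflexive (≡.cong f (≡.sym (ℕ.+-identityʳ i))))
  productFrom-last f i (suc m) = begin
    f i * productFrom f (suc i) (suc m)                  ≈⟨ *-congˡ (productFrom-last f (suc i) m) ⟩
    f i * (f (suc i ℕ.+ m) * productFrom f (suc i) m)    ≈⟨ x*yz≈y*xz _ _ _ ⟩
    f (suc i ℕ.+ m) * productFrom f i (suc m)            ≡⟨ ≡.cong (λ j → f j * productFrom f i (suc m)) (ℕ.+-suc i m) ⟨
    f (i ℕ.+ suc m) * productFrom f i (suc m)            ∎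

  product-productFrom : ∀ f i m → product {m} (λ j → f (i ℕ.+ toℕ j)) ≡ productFrom f i m
  product-productFrom f i zero    = ≡.refl
  product-productFrom f i (suc m) = ≡.cong₂ _*_ (≡.cong f (ℕ.+-identityʳ i))
    (≡.trans (product-cong-≗ {m} λ j → ≡.cong f (ℕ.+-suc i (toℕ j))) (product-productFrom f (suc i) m))

  -- The span of `b 0`, ..., `b (i - 1)`, given by its closure rules instead of coefficients, so
  -- that a linear property is checked by recursion on the derivation.
  data Below (b : ℕ → Row) (i : ℕ) : Row → Set (r ⊔ e) where
    basis  : ∀ {j} → j ℕ.< i → Below b i (b j)
    plus   : ∀ {f g} → Below b i f → Below b i g → Below b i (f ⊹ g)
    scaled : ∀ w {f} → Below b i f → Below b i (w ∙ f)
    resp   : ∀ {f g} → f ≋ g → Below b i f → Below b i g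
    null   : Below b i 𝟎

  Leading : (ℕ → Row) → ℕ → Carrier → Row → Set (r ⊔ e)
  Leading b i β f = ∃[ g ] Below b i g × f ≋ (β ∙ b i) ⊹ g

  Kills : ∀ {m} → (Vec Row m → Carrier) → Row → Set (r ⊔ e)
  Kills D f = ∀ i xs → D (xs [ i ]≔ f) ≈ 0#

  kills-below : ∀ {m D} → MultiAlternating m D → ∀ {b i} → (∀ {j} → j ℕ.< i → Kills D (b j)) →
                ∀ {f} → Below b i f → Kills D f
  kills-below D-alt kill (basis j<i)  s xs = kill j<i s xs
  kills-below D-alt kill (plus B B′)  s xs = trans (add (slot-linear D-alt s xs) _ _)
    (trans (+-cong (kills-below D-alt kill B s xs) (kills-below D-alt kill B′ s xs)) (+-identityʳ _))
  kills-below D-alt kill (scaled w B) s xs = trans (scale (slot-linear D-alt s xs) w _)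
    (trans (*-congˡ (kills-below D-alt kill B s xs)) (zeroʳ w))
  kills-below D-alt kill (resp f≋g B) s xs =
    trans (sym (cong⁺ (slot-linear D-alt s xs) f≋g)) (kills-below D-alt kill B s xs)
  kills-below D-alt kill null         s xs = vanish (slot-linear D-alt s xs) (λ _ → refl)

  -- A triangular change of rows, carried out from the top. The lower part of the first row is a
  -- combination of rows that `D` kills. Once `b i` is fixed as a row, it is itself killed in all
  -- later slots, being repeated there.
  alternating-leading : ∀ {m D} → MultiAlternating m D → ∀ {b F β} i → (∀ j → Leading b j (β j) (F j)) →
                        (∀ {j} → j ℕ.< i → Kills D (b j)) →
                        D (rowsFrom F i m) ≈ productFrom β i m * D (rowsFrom b i m)
  alternating-leading {zero}  D-alt i lead kill = sym (*-identityˡ _)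
  alternating-leading {suc m} {D} D-alt {b} {F} {β} i lead kill with lead i
  ... | g , B , F≋ = begin
    D (F i ∷ rest)                                    ≈⟨ cong⁺ lin F≋ ⟩
    D ((β i ∙ b i) ⊹ g ∷ rest)                        ≈⟨ add lin _ g ⟩
    D ((β i ∙ b i) ∷ rest) + D (g ∷ rest)             ≈⟨ +-cong (scale lin (β i) (b i))
                                                                 (kills-below D-alt kill B zero (b i ∷ rest)) ⟩
    β i * D (b i ∷ rest) + 0#                         ≈⟨ +-identityʳ _ ⟩
    β i * D (b i ∷ rest)                              ≈⟨ *-congˡ (alternating-leading (tail-alternating D-alt (b i)) (suc i) lead kill′) ⟩
    β i * (productFrom β (suc i) m * D (rowsFrom b i (suc m)))  ≈⟨ *-assoc _ _ _ ⟨
    β i * productFrom β (suc i) m * D (rowsFrom b i (suc m))    ∎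
    where
    rest : Vec Row m
    rest = rowsFrom F (suc i) m
    lin : Linear (λ x → D (x ∷ rest))
    lin = head-linear D-alt rest
    kill′ : ∀ {j} → j ℕ.< suc i → Kills (D ∘ (b i ∷_)) (b j)
    kill′ {j} j<1+i s xs with ℕ.m<1+n⇒m<n∨m≡n j<1+i
    ... | inj₁ j<i    = kill j<i (suc s) (b i ∷ xs)
    ... | inj₂ ≡.refl = vanish-repeated D-alt (b i ∷ (xs [ s ]≔ b i)) {zero} {suc s} (λ ())
                          (≡.sym (Vec.lookup∘updateAt s xs))

  unit : ℕ → Row
  unit i k = if does (i ℕ.≟ k) then 1# else 0#

  unit-diagonal : ∀ i → unit i i ≈ 1#
  unit-diagonal i rewrite dec-true (i ℕ.≟ i) ≡.refl = refl

  unit-offDiagonal : ∀ {i k} → i ≢ k → unit i k ≈ 0#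
  unit-offDiagonal {i} {k} i≢k rewrite dec-false (i ℕ.≟ k) i≢k = refl

  expand-insertAt : ∀ {m} k (D : Vec Row m → Carrier) xs i → (∀ j → lookup xs j k ≈ 0#) →
                    expand k D (insertAt xs i (unit k)) ≈ (- 1#) ^ toℕ i * D xs
  expand-insertAt k D xs       zero    col≈0 =
    trans (expand-head k D (unit k) xs col≈0) (*-congʳ (unit-diagonal k))
  expand-insertAt k D (x ∷ xs) (suc i) col≈0 = begin
    x k * D (insertAt xs i (unit k)) - expand k (D ∘ (x ∷_)) (insertAt xs i (unit k))
      ≈⟨ +-cong (trans (*-congʳ (col≈0 zero)) (zeroˡ _))
                (-‿cong (expand-insertAt k (D ∘ (x ∷_)) xs i (col≈0 ∘ suc))) ⟩
    0# - (- 1#) ^ toℕ i * D (x ∷ xs)      ≈⟨ +-identityˡ _ ⟩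
    - ((- 1#) ^ toℕ i * D (x ∷ xs))       ≈⟨ -1*x≈-x _ ⟨
    - 1# * ((- 1#) ^ toℕ i * D (x ∷ xs))  ≈⟨ *-assoc _ _ _ ⟨
    (- 1#) ^ suc (toℕ i) * D (x ∷ xs)     ∎

  -- Here `q` lists each of the values k, ..., n - 1 once. Only the row with value `k` meets column
  -- `k`; striking it out leaves the same situation for k + 1, which is why the columns are allowed
  -- to start at `k`.
  det-permutation : ∀ {n} m k (q : Vec (Fin n) m) → (∀ i j → lookup q i ≡ lookup q j → i ≡ j) →
                    (∀ i → k ℕ.≤ toℕ (lookup q i)) → (∀ v → k ℕ.≤ toℕ v → ∃[ i ] lookup q i ≡ v) →
                    k ℕ.+ m ≡ n → det m k (map (unit ∘ toℕ) q) ≈ (- 1#) ^ inversions q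
  det-permutation zero    k [] inj bound cover eq = refl
  det-permutation {n} (suc m) k q inj bound cover eq = go (cover v (ℕ.≤-reflexive (≡.sym v≡k)))
    where
    k<n : k ℕ.< n
    k<n = ≡.subst (k ℕ.<_) (≡.trans (≡.sym (ℕ.+-suc k m)) eq) (ℕ.s≤s (ℕ.m≤m+n k m))
    v : Fin n
    v = fromℕ< k<n
    v≡k : toℕ v ≡ k
    v≡k = Fin.toℕ-fromℕ< k<n
    go : (∃[ i ] lookup q i ≡ v) → det (suc m) k (map (unit ∘ toℕ) q) ≈ (- 1#) ^ inversions q
    go (i , qᵢ≡v) = begin
      det (suc m) k (map (unit ∘ toℕ) q)
        ≡⟨ ≡.cong (expand k (det m (suc k)))
             (≡.trans (≡.cong (map (unit ∘ toℕ)) q≡) (≡.trans (Vec.map-insertAt _ v q′ i)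
               (≡.cong (insertAt _ i ∘ unit) v≡k))) ⟩
      expand k (det m (suc k)) (insertAt (map (unit ∘ toℕ) q′) i (unit k))
        ≈⟨ expand-insertAt k (det m (suc k)) (map (unit ∘ toℕ) q′) i column ⟩
      (- 1#) ^ toℕ i * det m (suc k) (map (unit ∘ toℕ) q′)
        ≈⟨ *-congˡ (det-permutation m (suc k) q′ inj′ bound′ cover′ (≡.trans (≡.sym (ℕ.+-suc k m)) eq)) ⟩
      (- 1#) ^ toℕ i * (- 1#) ^ inversions q′
        ≈⟨ ^-homo-* (- 1#) (toℕ i) (inversions q′) ⟨
      (- 1#) ^ (toℕ i ℕ.+ inversions q′)
        ≡⟨ ≡.cong ((- 1#) ^_) (≡.trans (≡.sym (inversions-insertAt q′ i v above)) (≡.cong inversions (≡.sym q≡))) ⟩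
      (- 1#) ^ inversions q ∎
      where
      q′ : Vec (Fin n) m
      q′ = removeAt q i
      q≡ : q ≡ insertAt q′ i v
      q≡ = ≡.trans (≡.sym (Vec.insertAt-removeAt q i)) (≡.cong (insertAt q′ i) qᵢ≡v)
      q′-lookup : ∀ j → lookup q′ j ≡ lookup q (Fin.punchIn i j)
      q′-lookup j = ≡.trans (≡.sym (Vec.insertAt-punchIn q′ i v j)) (≡.cong (λ p → lookup p (Fin.punchIn i j)) (≡.sym q≡))
      inj′ : ∀ j l → lookup q′ j ≡ lookup q′ l → j ≡ l
      inj′ j l e = Fin.punchIn-injective i j l
        (inj _ _ (≡.trans (≡.sym (q′-lookup j)) (≡.trans e (q′-lookup l))))
      bound′ : ∀ j → k ℕ.< toℕ (lookup q′ j)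
      bound′ j = ℕ.≤∧≢⇒< (≡.subst (λ p → k ℕ.≤ toℕ p) (≡.sym (q′-lookup j)) (bound _))
        λ k≡ → Fin.punchInᵢ≢i i j (inj _ _ (Fin.toℕ-injective (≡.trans (≡.cong toℕ (≡.sym (q′-lookup j)))
          (≡.trans (≡.sym k≡) (≡.trans (≡.sym v≡k) (≡.cong toℕ (≡.sym qᵢ≡v)))))))
      cover′ : ∀ w → k ℕ.< toℕ w → ∃[ j ] lookup q′ j ≡ w
      cover′ w k<w with cover w (ℕ.<⇒≤ k<w)
      ... | l , qₗ≡w = Fin.punchOut i≢l ,
        ≡.trans (q′-lookup _) (≡.trans (≡.cong (lookup q) (Fin.punchIn-punchOut i≢l)) qₗ≡w)
        where
        i≢l : i ≢ l
        i≢l ≡.refl = ℕ.<⇒≢ k<w (≡.trans (≡.sym v≡k) (≡.cong toℕ (≡.trans (≡.sym qᵢ≡v) qₗ≡w)))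
      above : ∀ j → v Fin.< lookup q′ j
      above j = ≡.subst (ℕ._< toℕ (lookup q′ j)) (≡.sym v≡k) (bound′ j)
      column : ∀ j → lookup (map (unit ∘ toℕ) q′) j k ≈ 0#
      column j rewrite Vec.lookup-map j (unit ∘ toℕ) q′ = unit-offDiagonal (ℕ.<⇒≢ (bound′ j) ∘ ≡.sym)

  below-mono : ∀ {b i j f} → i ℕ.≤ j → Below b i f → Below b j f
  below-mono i≤j (basis l<i)  = basis (ℕ.<-≤-trans l<i i≤j)
  below-mono i≤j (plus B B′)  = plus (below-mono i≤j B) (below-mono i≤j B′)
  below-mono i≤j (scaled w B) = scaled w (below-mono i≤j B)
  below-mono i≤j (resp f≋g B) = resp f≋g (below-mono i≤j B)
  below-mono i≤j null         = null

  below-sum : ∀ {b i m} (w : Fin m → Carrier) {F : Fin m → Row} → (∀ j → Below b i (F j)) →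
              Below b i (λ k → sum (λ j → w j * F j k))
  below-sum {m = zero}  w B = null
  below-sum {m = suc m} w B = plus (scaled (w zero) (B zero)) (below-sum (w ∘ suc) (B ∘ suc))

  leading-below : ∀ {b i β f} → Leading b i β f → Below b (suc i) f
  leading-below {i = i} {β} (g , B , f≋) = resp (λ k → sym (f≋ k))
    (plus (scaled β (basis (ℕ.n<1+n i))) (below-mono (ℕ.n≤1+n i) B))

  leading-resp : ∀ {b i β f g} → f ≋ g → Leading b i β f → Leading b i β g
  leading-resp f≋g (h , B , f≋) = h , B , λ k → trans (sym (f≋g k)) (f≋ k)

  leading-basis : ∀ {b} i → Leading b i 1# (b i)
  leading-basis i = 𝟎 , null , λ k → sym (trans (+-identityʳ _) (*-identityˡ _))

  leading-plus : ∀ {b i β f g} → Leading b i β f → Below b i g → Leading b i β (f ⊹ g)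
  leading-plus (h , B , f≋) B′ = _ , plus B B′ , λ k → trans (+-congʳ (f≋ k)) (+-assoc _ _ _)

  leading-scaled : ∀ {b i β f} w → Leading b i β f → Leading b i (w * β) (w ∙ f)
  leading-scaled w (h , B , f≋) = _ , scaled w B , λ k →
    trans (*-congˡ (f≋ k)) (trans (distribˡ w _ _) (+-congʳ (sym (*-assoc _ _ _))))

  leading-cong : ∀ {b i β β′ f} → β ≈ β′ → Leading b i β f → Leading b i β′ f
  leading-cong β≈β′ (h , B , f≋) = h , B , λ k → trans (f≋ k) (+-congʳ (*-congʳ β≈β′))

-- Finite maps and updates of vectors

injective⇒covering : ∀ {n} (f : Fin n → Fin n) → (∀ i j → f i ≡ f j → i ≡ j) → ∀ v → ∃[ i ] f i ≡ v
injective⇒covering {suc n} f inj v with Fin.any? (λ i → f i Fin.≟ v)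
... | yes hit  = hit
... | no  miss = contradiction (λ {i} {j} e → inj i j (Fin.punchOut-injective (miss′ i) (miss′ j) e))
                               (Fin.<⇒notInjective {f = λ i → Fin.punchOut (miss′ i)} (ℕ.n<1+n n))
  where
  miss′ : ∀ i → v ≢ f i
  miss′ i v≡ = miss (i , ≡.sym v≡)

sum-map-[]≔-< : ∀ {A : Set} (f : A → ℕ) {m} (xs : Vec A m) i {x} → f x ℕ.< f (lookup xs i) →
                Vec.sum (map f (xs [ i ]≔ x)) ℕ.< Vec.sum (map f xs)
sum-map-[]≔-< f (y ∷ xs) zero    lt = ℕ.+-monoˡ-< _ lt
sum-map-[]≔-< f (y ∷ xs) (suc i) lt = ℕ.+-monoʳ-< (f y) (sum-map-[]≔-< f xs i lt)

updateAt-injective : ∀ {A : Set} {f : A → A} → (∀ {x y} → f x ≡ f y → x ≡ y) →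
                     ∀ {m} (xs ys : Vec A m) i → updateAt xs i f ≡ updateAt ys i f → xs ≡ ys
updateAt-injective f-inj (x ∷ xs) (y ∷ ys) zero    eq =
  ≡.cong₂ _∷_ (f-inj (Vec.∷-injectiveˡ eq)) (Vec.∷-injectiveʳ eq)
updateAt-injective f-inj (x ∷ xs) (y ∷ ys) (suc i) eq =
  ≡.cong₂ _∷_ (Vec.∷-injectiveˡ eq) (updateAt-injective f-inj xs ys i (Vec.∷-injectiveʳ eq))

-- Sums over finite sets given by predicates

module Summation {r e} (R : CommutativeRing r e) where
  open CommutativeRing R hiding (zero)
  open import Algebra.Definitions.RawSemiring (Semiring.rawSemiring semiring) using (sum)
  open import Data.List.Relation.Binary.Permutation.Setoid.Properties setoid using (foldr-commMonoid)

  total : {A : Set} → (A → Carrier) → List A → Carrier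
  total f xs = foldr _+_ 0# (List.map f xs)

  private variable
    A B : Set
    P Q : A → Set
    f g : A → Carrier
    s t : Carrier

  total-++ : ∀ (f : A → Carrier) xs ys → total f (xs ++ ys) ≈ total f xs + total f ys
  total-++ f []       ys = sym (+-identityˡ _)
  total-++ f (x ∷ xs) ys = trans (+-congˡ (total-++ f xs ys)) (sym (+-assoc _ _ _))

  total-↭ : ∀ (f : A → Carrier) {xs ys} → xs ↭ ys → total f xs ≈ total f ys
  total-↭ f p = foldr-commMonoid +-isCommutativeMonoid (↭⇒↭ₛ′ isEquivalence (↭-map⁺ f p))

  -- A relation between a set and its sum, with the enumerating list kept inside. Bijections and
  -- case distinctions thus act on predicates, and no two lists need comparing until
  -- `hasSum-unique`.
  record HasSum {A : Set} (P : A → Set) (f : A → Carrier) (t : Carrier) : Set e where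
    constructor hasSum
    field
      support : List A
      unique  : Unique support
      member  : ∀ x → x ∈ support ⇔ P x
      total≈  : total f support ≈ t

  -- Two lists without repetition and with the same members are permutations of each other.
  hasSum-unique : HasSum P f s → HasSum P f t → s ≈ t
  hasSum-unique {f = f} (hasSum xs uxs mxs xs≈s) (hasSum ys uys mys ys≈t) =
    trans (sym xs≈s) (trans (total-↭ f (∼bag⇒↭ (unique∧set⇒bag uxs uys same))) ys≈t)
    where
    open Equivalence
    same : ∀ {x} → x ∈ xs ⇔ x ∈ ys
    same {x} = mk⇔ (from (mys x) ∘ to (mxs x)) (from (mxs x) ∘ to (mys x))

  hasSum-resp : (∀ x → P x ⇔ Q x) → s ≈ t → HasSum P f s → HasSum Q f t
  hasSum-resp P⇔Q s≈t (hasSum xs u m xs≈s) = hasSum xs u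
    (λ x → mk⇔ (to (P⇔Q x) ∘ to (m x)) (from (m x) ∘ from (P⇔Q x))) (trans xs≈s s≈t)
    where open Equivalence

  hasSum-∅ : (∀ x → ¬ P x) → HasSum P f 0#
  hasSum-∅ ¬P = hasSum [] [] (λ x → mk⇔ (λ ()) (λ p → contradiction p (¬P x))) refl

  hasSum-singleton : ∀ {f : A → Carrier} x → HasSum (_≡ x) f (f x)
  hasSum-singleton x = hasSum (x ∷ []) ([] ∷ [])
    (λ y → mk⇔ (λ { (here p) → p ; (there ()) }) here) (+-identityʳ _)

  hasSum-⊎ : (∀ {x} → P x → ¬ Q x) → HasSum P f s → HasSum Q f t →
             HasSum (λ x → P x ⊎ Q x) f (s + t)
  hasSum-⊎ {f = f} disj (hasSum xs uxs mxs xs≈s) (hasSum ys uys mys ys≈t) = hasSum (xs ++ ys)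
    (Unique.++⁺ uxs uys λ (x∈xs , x∈ys) → disj (to (mxs _) x∈xs) (to (mys _) x∈ys))
    (λ x → mk⇔
      (λ x∈ → [ inj₁ ∘ to (mxs x) , inj₂ ∘ to (mys x) ]′ (∈-++⁻ xs x∈))
      [ ∈-++⁺ˡ ∘ from (mxs x) , ∈-++⁺ʳ xs ∘ from (mys x) ]′)
    (trans (total-++ f xs ys) (+-cong xs≈s ys≈t))
    where open Equivalence

  hasSum-∃ : ∀ {m} {P : Fin m → A → Set} {t : Fin m → Carrier} →
             (∀ {i j x} → P i x → P j x → i ≡ j) → (∀ i → HasSum (P i) f (t i)) →
             HasSum (λ x → ∃[ i ] P i x) f (sum t)
  hasSum-∃ {m = zero}  disj h = hasSum-∅ λ _ ()
  hasSum-∃ {m = suc m} disj h = hasSum-resp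
    (λ x → mk⇔ (λ { (inj₁ p) → zero , p ; (inj₂ (i , p)) → suc i , p })
               (λ { (zero , p) → inj₁ p ; (suc i , p) → inj₂ (i , p) }))
    refl
    (hasSum-⊎ (λ { p (i , q) → contradiction (disj p q) λ () }) (h zero)
      (hasSum-∃ (λ p q → Fin.suc-injective (disj p q)) (h ∘ suc)))

  hasSum-image : ∀ {P : A → Set} {g : B → Carrier} {h : A → B} w →
                 (∀ {x y} → h x ≡ h y → x ≡ y) → (∀ {x} → P x → g (h x) ≈ w * f x) →
                 HasSum P f t → HasSum (λ y → ∃[ x ] P x × h x ≡ y) g (w * t)
  hasSum-image {f = f} {P = P} {g} {h} w inj g∘h (hasSum xs u m xs≈t) = hasSum (List.map h xs)
    (Unique.map⁺ inj u)
    (λ y → mk⇔ (λ y∈ → let (x , x∈ , y≡) = ∈-map⁻ h y∈ in x , to (m x) x∈ , ≡.sym y≡)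
               (λ { (x , p , ≡.refl) → ∈-map⁺ h (from (m x) p) }))
    (trans (scaled xs (to (m _))) (*-congˡ xs≈t))
    where
    open Equivalence
    scaled : ∀ xs → (∀ {x} → x ∈ xs → P x) → total g (List.map h xs) ≈ w * total f xs
    scaled []       _ = sym (zeroʳ w)
    scaled (x ∷ xs) p = trans (+-cong (g∘h (p (here ≡.refl))) (scaled xs (p ∘ there))) (sym (distribˡ w _ _))

-- The Lindström-Gessel-Viennot lemma for families of runs

module Lattice {r e} (R : CommutativeRing r e) (ℓ : ℕ)
               (b : Fin (suc ℓ) → ℤ → CommutativeRing.Carrier R)
               (c : ℤ → CommutativeRing.Carrier R) (n : ℕ) where
  open CommutativeRing R hiding (zero)
  open import Algebra.Properties.Semiring.Exp semiring using (_^_)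
  open import Algebra.Definitions.RawSemiring (Semiring.rawSemiring semiring) using (sum; product)
  open import Algebra.Properties.CommutativeSemigroup *-commutativeSemigroup
    using () renaming (x∙yz≈y∙xz to x*yz≈y*xz)
  open import Algebra.Properties.Monoid.Sum *-monoid using () renaming (sum-cong-≋ to product-cong)
  open Determinant R
  open Linear
  open Summation R
  open import Relation.Binary.Reasoning.Setoid setoid hiding (stop)

  linear-sum : ∀ {L} → Linear L → ∀ {m} (w : Fin m → Carrier) (F : Fin m → Row) →
               L (λ k → sum (λ i → w i * F i k)) ≈ sum (λ i → w i * L (F i))
  linear-sum L-lin {zero}  w F = vanish L-lin (λ _ → refl)
  linear-sum L-lin {suc m} w F = trans (add L-lin (w zero ∙ F zero) _)
    (+-cong (scale L-lin (w zero) (F zero)) (linear-sum L-lin (w ∘ suc) (F ∘ suc)))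

  product-scaleAt : ∀ {m} {f g : Fin m → Carrier} i w → (∀ j → j ≢ i → f j ≈ g j) → f i ≈ w * g i →
                    product f ≈ w * product g
  product-scaleAt {f = f} {g} zero w off at = begin
    f zero * product (f ∘ suc)        ≈⟨ *-cong at (product-cong (λ j → off (suc j) λ ())) ⟩
    w * g zero * product (g ∘ suc)    ≈⟨ *-assoc _ _ _ ⟩
    w * (g zero * product (g ∘ suc))  ∎
  product-scaleAt {f = f} {g} (suc i) w off at = begin
    f zero * product (f ∘ suc)
      ≈⟨ *-cong (off zero λ ()) (product-scaleAt i w (λ j j≢i → off (suc j) (j≢i ∘ Fin.suc-injective)) at) ⟩
    g zero * (w * product (g ∘ suc))  ≈⟨ x*yz≈y*xz _ _ _ ⟩
    w * (g zero * product (g ∘ suc))  ∎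

  product-one : ∀ m → product {m} (λ _ → 1#) ≈ 1#
  product-one zero    = refl
  product-one (suc m) = trans (*-identityˡ _) (product-one m)

  -- (r , y) stands for the point of ordinate y on the line x + y = (n - r) ℓ.
  Vertex : Set
  Vertex = ℕ × ℕ

  line : ℕ → ℤ
  line r = + n ℤ.- + r

  Word : Set
  Word = List (Step ℓ)

  move : Vertex → Step ℓ → Vertex
  move (r , y) (a i) = pred r , y ℕ.+ (ℓ ∸ toℕ i)
  move (r , y) down  = r , pred y

  trail : Vertex → Word → List Vertex
  trail v []      = v ∷ []
  trail v (u ∷ w) = v ∷ trail (move v u) w

  moveWeight : Vertex → Step ℓ → Carrier
  moveWeight (r , y) (a i) = b i (line r)
  moveWeight (r , y) down  = c (line r)

  trailWeight : Vertex → Word → Carrier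
  trailWeight v []      = 1#
  trailWeight v (u ∷ w) = moveWeight v u * trailWeight (move v u) w

  -- A path that has been consumed up to its target `k` becomes `done k`: it occupies no vertex any
  -- more, but its value of the permutation is remembered.
  data State : Set where
    active : Vertex → State
    done   : Fin n → State

  trace : State → Word → List Vertex
  trace (active v) w = trail v w
  trace (done k)   w = []

  traceWeight : State → Word → Carrier
  traceWeight (active v) w = trailWeight v w
  traceWeight (done k)   w = 1#

  -- Since `r` and `y` are natural numbers, the indices of `slide` and `jump` alone keep a run above
  -- the axis and prevent it from passing line `n`, the last one with a target.
  data Run : State → Word → Fin n → Set where
    stop  : ∀ {k} → Run (done k) [] k
    halt  : ∀ {r k} → r ℕ.+ suc (toℕ k) ≡ n → Run (active (r , 0)) [] k
    slide : ∀ {r y w k} → Run (active (r , y)) w k → Run (active (r , suc y)) (down ∷ w) k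
    jump  : ∀ {r y i w k} → Run (active (r , y ℕ.+ (ℓ ∸ toℕ i))) w k →
            Run (active (suc r , y)) (a i ∷ w) k

  Configuration : Set
  Configuration = Vec Word n × Vec (Fin n) n

  record Valid (s : Vec State n) (x : Configuration) : Set where
    constructor valid
    ws = proj₁ x
    σ  = proj₂ x
    field
      run       : ∀ i → Run (lookup s i) (lookup ws i) (lookup σ i)
      injective : ∀ i j → lookup σ i ≡ lookup σ j → i ≡ j
      disjoint  : ∀ i j → i ≢ j → Disjoint (trace (lookup s i) (lookup ws i)) (trace (lookup s j) (lookup ws j))

  weight : Vec State n → Configuration → Carrier
  weight s (ws , σ) = (- 1#) ^ inversions σ * product (λ i → traceWeight (lookup s i) (lookup ws i))

  -- A jump lowers `r` by one and raises the ordinate by at most `ℓ`, so the factor `suc ℓ` makes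
  -- every step go down. The outer `suc` reserves 0 for `done`, so that halting goes down as well.
  level : State → ℕ
  level (active (r , y)) = suc (suc ℓ ℕ.* r ℕ.+ y)
  level (done k)         = 0

  level-slide : ∀ r y → level (active (r , y)) ℕ.< level (active (r , suc y))
  level-slide r y = ℕ.s≤s (ℕ.+-monoʳ-< (suc ℓ ℕ.* r) (ℕ.n<1+n y))

  level-jump : ∀ r y (i : Fin (suc ℓ)) →
               level (active (r , y ℕ.+ (ℓ ∸ toℕ i))) ℕ.< level (active (suc r , y))
  level-jump r y i = ℕ.s≤s (ℕ.≤-trans
    (ℕ.s≤s (ℕ.+-monoʳ-≤ (suc ℓ ℕ.* r) (ℕ.+-monoʳ-≤ y (ℕ.m∸n≤m ℓ (toℕ i)))))
    (ℕ.≤-reflexive (eq ℓ r y)))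
    where
    eq : ∀ ℓ r y → suc (suc ℓ ℕ.* r ℕ.+ (y ℕ.+ ℓ)) ≡ suc ℓ ℕ.* suc r ℕ.+ y
    eq = ℕ-Solver.solve-∀

  trace-level : ∀ {s w k v} → Run s w k → v ∈ trace s w → level (active v) ℕ.< level s ⊎ s ≡ active v
  trace-level (halt _)  (here ≡.refl) = inj₂ ≡.refl
  trace-level (slide _) (here ≡.refl) = inj₂ ≡.refl
  trace-level (slide {r} {y} ρ) (there v∈) with trace-level ρ v∈
  ... | inj₁ lt     = inj₁ (ℕ.<-trans lt (level-slide r y))
  ... | inj₂ ≡.refl = inj₁ (level-slide r y)
  trace-level (jump _)  (here ≡.refl) = inj₂ ≡.refl
  trace-level (jump {r} {y} {i} ρ) (there v∈) with trace-level ρ v∈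
  ... | inj₁ lt     = inj₁ (ℕ.<-trans lt (level-jump r y i))
  ... | inj₂ ≡.refl = inj₁ (level-jump r y i)

  -- `active-row r y k` is the generating function of the runs from (r , y) to target k.
  active-row halt-row slide-row jump-row : ℕ → ℕ → Row
  active-row r y = halt-row r y ⊹ (slide-row r y ⊹ jump-row r y)
  halt-row r zero    k = unit (r ℕ.+ suc k) n
  halt-row r (suc y) = 𝟎
  slide-row r zero    = 𝟎
  slide-row r (suc y) = c (line r) ∙ active-row r y
  jump-row zero    y = 𝟎
  jump-row (suc r) y k = sum λ i → b i (line (suc r)) * active-row r (y ℕ.+ (ℓ ∸ toℕ i)) k

  row : State → Row
  row (active (r , y)) = active-row r y
  row (done k)         = unit (toℕ k)

  det-states : Vec State n → Carrier
  det-states s = det n 0 (map row s)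

  -- Common to adding a step, removing a step and halting: one slot changes, and disjointness has to
  -- be checked only for vertices that are new there.
  valid-update : ∀ {s s′ ws ws′ σ} i → Valid s (ws , σ) →
    (∀ j → j ≢ i → lookup s′ j ≡ lookup s j) → (∀ j → j ≢ i → lookup ws′ j ≡ lookup ws j) →
    Run (lookup s′ i) (lookup ws′ i) (lookup σ i) →
    (∀ {v} → v ∈ trace (lookup s′ i) (lookup ws′ i) → v ∈ trace (lookup s i) (lookup ws i) ⊎
             (∀ j → j ≢ i → v ∉ trace (lookup s j) (lookup ws j))) →
    Valid s′ (ws′ , σ)
  valid-update {s} {s′} {ws} {ws′} {σ} i (valid run inj disj) s≡ ws≡ runᵢ new = valid run′ inj disj′
    where
    run′ : ∀ j → Run (lookup s′ j) (lookup ws′ j) (lookup σ j)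
    run′ j with j Fin.≟ i
    ... | yes ≡.refl = runᵢ
    ... | no  j≢i rewrite s≡ j j≢i | ws≡ j j≢i = run j
    apart : ∀ j → j ≢ i → ∀ {v} → v ∈ trace (lookup s′ i) (lookup ws′ i) →
            v ∉ trace (lookup s′ j) (lookup ws′ j)
    apart j j≢i v∈i v∈j rewrite s≡ j j≢i | ws≡ j j≢i with new v∈i
    ... | inj₁ v∈i′  = disj i j (j≢i ∘ ≡.sym) (v∈i′ , v∈j)
    ... | inj₂ fresh = fresh j j≢i v∈j
    disj′ : ∀ j l → j ≢ l → Disjoint (trace (lookup s′ j) (lookup ws′ j)) (trace (lookup s′ l) (lookup ws′ l))
    disj′ j l j≢l {v} (v∈j , v∈l) with j Fin.≟ i | l Fin.≟ i
    ... | yes ≡.refl | yes ≡.refl = j≢l ≡.refl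
    ... | yes ≡.refl | no  l≢i    = apart l l≢i v∈j v∈l
    ... | no  j≢i    | yes ≡.refl = apart j j≢i v∈l v∈j
    ... | no  j≢i    | no  l≢i    rewrite s≡ j j≢i | ws≡ j j≢i | s≡ l l≢i | ws≡ l l≢i = disj j l j≢l (v∈j , v∈l)

  unstop : ∀ {s w k k′} → s ≡ done k → Run s w k′ → w ≡ [] × k′ ≡ k
  unstop ≡.refl stop = ≡.refl , ≡.refl

  -- The base of the recurrence. The words are forced to be empty and the permutation to be `q`;
  -- this is admissible exactly when `q` has no repetition, and then the determinant is that of a
  -- permutation matrix.
  all-done : ∀ q → HasSum (Valid (map done q)) (weight (map done q)) (det-states (map done q))
  all-done q with Fin.any? (λ i → Fin.any? λ j → ¬? (i Fin.≟ j) ×-dec (lookup q i Fin.≟ lookup q j))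
  ... | yes (i , j , i≢j , qᵢ≡qⱼ) = hasSum-resp (λ x → mk⇔ id id)
    (sym (vanish-repeated (det-alternating n 0) _ i≢j rows≡)) (hasSum-∅ empty)
    where
    rows≡ : lookup (map row (map done q)) i ≡ lookup (map row (map done q)) j
    rows≡ rewrite Vec.lookup-map i row (map done q) | Vec.lookup-map j row (map done q)
                | Vec.lookup-map i done q | Vec.lookup-map j done q = ≡.cong (unit ∘ toℕ) qᵢ≡qⱼ
    empty : ∀ x → ¬ Valid (map done q) x
    empty (ws , σ) (valid run inj _) = i≢j (inj i j (≡.trans (σ≡ i) (≡.trans qᵢ≡qⱼ (≡.sym (σ≡ j)))))
      where
      σ≡ : ∀ i → lookup σ i ≡ lookup q i
      σ≡ i = proj₂ (unstop (Vec.lookup-map i done q) (run i))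
  ... | no distinct = hasSum-resp same value (hasSum-singleton (replicate n [] , q))
    where
    inj : ∀ i j → lookup q i ≡ lookup q j → i ≡ j
    inj i j e with i Fin.≟ j
    ... | yes i≡j = i≡j
    ... | no  i≢j = contradiction (i , j , i≢j , e) distinct
    done? : ∀ i → lookup (map done q) i ≡ done (lookup q i)
    done? i = Vec.lookup-map i done q
    stop′ : ∀ {s w k} → s ≡ done k → w ≡ [] → Run s w k
    stop′ ≡.refl ≡.refl = stop
    no-trace : ∀ {s w k v} → s ≡ done k → v ∉ trace s w
    no-trace ≡.refl ()
    same : ∀ x → (x ≡ (replicate n [] , q)) ⇔ Valid (map done q) x
    same (ws , σ) = mk⇔
      (λ { ≡.refl → valid (λ i → stop′ (done? i) (Vec.lookup-replicate i [])) inj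
                          (λ i j _ (v∈ , _) → no-trace (done? i) v∈) })
      (λ (valid run _ _) → ≡.cong₂ _,_
        (Pointwise-≡⇒≡ (ext λ i → ≡.trans (proj₁ (unstop (done? i) (run i))) (≡.sym (Vec.lookup-replicate i []))))
        (Pointwise-≡⇒≡ (ext λ i → proj₂ (unstop (done? i) (run i)))))
    value : weight (map done q) (replicate n [] , q) ≈ det-states (map done q)
    value = begin
      (- 1#) ^ inversions q * product (λ i → traceWeight (lookup (map done q) i) (lookup (replicate n []) i))
        ≈⟨ *-congˡ (trans (product-cong λ i → reflexive (≡.cong (λ s → traceWeight s (lookup (replicate n []) i)) (done? i)))
                          (product-one n)) ⟩
      (- 1#) ^ inversions q * 1#        ≈⟨ *-identityʳ _ ⟩
      (- 1#) ^ inversions q             ≈⟨ det-permutation n 0 q inj (λ _ → ℕ.z≤n)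
                                             (λ v _ → injective⇒covering (lookup q) inj v) ≡.refl ⟨
      det n 0 (map (unit ∘ toℕ) q)      ≡⟨ ≡.cong (det n 0) (Vec.map-∘ row done q) ⟩
      det-states (map done q)           ∎

  maximal : ∀ {m} (s : Vec State m) → (∃[ q ] s ≡ map done q) ⊎
            (∃[ i ] ∃[ v ] lookup s i ≡ active v × (∀ j → level (lookup s j) ℕ.≤ level (active v)))
  maximal []      = inj₁ ([] , ≡.refl)
  maximal (p ∷ s) with maximal s
  maximal (done k ∷ s)   | inj₁ (q , ≡.refl) = inj₁ (k ∷ q , ≡.refl)
  maximal (active v ∷ s) | inj₁ (q , ≡.refl) = inj₂ (zero , v , ≡.refl , λ
    { zero    → ℕ.≤-refl
    ; (suc j) → ≡.subst (λ p → level p ℕ.≤ level (active v)) (≡.sym (Vec.lookup-map j done q)) ℕ.z≤n })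
  maximal (done k ∷ s)   | inj₂ (i , v , at , max) =
    inj₂ (suc i , v , at , λ { zero → ℕ.z≤n ; (suc j) → max j })
  maximal (active u ∷ s) | inj₂ (i , v , at , max) with ℕ.≤-total (level (active u)) (level (active v))
  ... | inj₁ u≤v = inj₂ (suc i , v , at , λ { zero → u≤v ; (suc j) → max j })
  ... | inj₂ v≤u = inj₂ (zero , u , ≡.refl , λ { zero → ℕ.≤-refl ; (suc j) → ℕ.≤-trans (max j) v≤u })

  isActive? : ∀ p v → Dec (p ≡ active v)
  isActive? (done k)   v = no λ ()
  isActive? (active u) v = map′ (≡.cong active) (λ { ≡.refl → ≡.refl })
                                (Product.≡-dec ℕ._≟_ ℕ._≟_ u v)

  start∈trail : ∀ v w → v ∈ trail v w
  start∈trail v []      = here ≡.refl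
  start∈trail v (u ∷ w) = here ≡.refl

  -- The two paths share their initial vertex, so no configuration is valid, while the determinant
  -- has two equal rows.
  collision : ∀ {s i j v} → j ≢ i → lookup s i ≡ active v → lookup s j ≡ active v →
              HasSum (Valid s) (weight s) (det-states s)
  collision {s} {i} {j} {v} j≢i sᵢ≡ sⱼ≡ = hasSum-resp (λ x → mk⇔ id id)
    (sym (vanish-repeated (det-alternating n 0) _ j≢i rows≡)) (hasSum-∅ empty)
    where
    rows≡ : lookup (map row s) j ≡ lookup (map row s) i
    rows≡ rewrite Vec.lookup-map i row s | Vec.lookup-map j row s | sᵢ≡ | sⱼ≡ = ≡.refl
    starts : ∀ {p} w → p ≡ active v → v ∈ trace p w
    starts w ≡.refl = start∈trail v w
    empty : ∀ x → ¬ Valid s x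
    empty (ws , σ) (valid _ _ disj) = disj j i j≢i (starts (lookup ws j) sⱼ≡ , starts (lookup ws i) sᵢ≡)

  module Advance (s : Vec State n) (i : Fin n) (v : Vertex) (sᵢ≡ : lookup s i ≡ active v)
                 (max : ∀ j → level (lookup s j) ℕ.≤ level (active v))
                 (alone : ∀ j → j ≢ i → lookup s j ≢ active v) where

    -- Levels decrease along a run, and no run starts above the level of `v`. So another path could
    -- meet `v` only at its own start, which `alone` excludes.
    fresh : ∀ {j w k} → j ≢ i → Run (lookup s j) w k → v ∉ trace (lookup s j) w
    fresh {j} j≢i ρ v∈ with trace-level ρ v∈
    ... | inj₁ lt  = ℕ.<⇒≱ lt (max j)
    ... | inj₂ sⱼ≡ = alone j j≢i sⱼ≡

    updated : ∀ p → lookup (s [ i ]≔ p) i ≡ p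
    updated p = Vec.lookup∘update i s p

    unchanged : ∀ p j → j ≢ i → lookup (s [ i ]≔ p) j ≡ lookup s j
    unchanged p j j≢i = Vec.lookup∘update′ j≢i s p

    substitute : Row → Carrier
    substitute f = det n 0 (map row s [ i ]≔ f)

    substitute-linear : Linear substitute
    substitute-linear = slot-linear (det-alternating n 0) i (map row s)

    det-substitute : ∀ p → det-states (s [ i ]≔ p) ≡ substitute (row p)
    det-substitute p = ≡.cong (det n 0) (Vec.map-[]≔ row s i)

    StepsBy : Step ℓ → Configuration → Set
    StepsBy u x = Valid s x × ∃[ w ] lookup (proj₁ x) i ≡ u ∷ w

    Halts : Configuration → Set
    Halts x = Valid s x × lookup (proj₁ x) i ≡ []

    module _ (u : Step ℓ) (pred-run : ∀ {w k} → Run (active v) (u ∷ w) k → Run (active (move v u)) w k)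
             (suc-run : ∀ {w k} → Run (active (move v u)) w k → Run (active v) (u ∷ w) k) where

      private
        p : State
        p = active (move v u)

        s′ : Vec State n
        s′ = s [ i ]≔ p

        h : Configuration → Configuration
        h (ws , σ) = updateAt ws i (u ∷_) , σ

        h-injective : ∀ {x y} → h x ≡ h y → x ≡ y
        h-injective eq = ≡.cong₂ _,_ (updateAt-injective List.∷-injectiveʳ _ _ i (Product.,-injectiveˡ eq))
                                     (Product.,-injectiveʳ eq)

        extend : ∀ x → Valid s′ x → Valid s (h x)
        extend (ws , σ) V@(valid run _ _) = valid-update {s′} {s} i V
          (λ j j≢i → ≡.sym (unchanged p j j≢i)) (λ j j≢i → Vec.lookup∘updateAt′ j i j≢i ws)
          (≡.subst₂ (λ q w → Run q w (lookup σ i)) (≡.sym sᵢ≡) (≡.sym ws≡)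
            (suc-run (≡.subst (λ q → Run q (lookup ws i) (lookup σ i)) (updated p) (run i))))
          new
          where
          ws≡ : lookup (updateAt ws i (u ∷_)) i ≡ u ∷ lookup ws i
          ws≡ = Vec.lookup∘updateAt i ws
          new : ∀ {x} → x ∈ trace (lookup s i) (lookup (updateAt ws i (u ∷_)) i) →
                x ∈ trace (lookup s′ i) (lookup ws i) ⊎
                (∀ j → j ≢ i → x ∉ trace (lookup s′ j) (lookup ws j))
          new x∈ rewrite ws≡ | sᵢ≡ | updated p with x∈
          ... | there x∈′   = inj₁ x∈′
          ... | here ≡.refl = inj₂ λ j j≢i → ≡.subst (λ q → v ∉ trace q (lookup ws j)) (≡.sym (unchanged p j j≢i))
                (fresh j≢i (≡.subst (λ q → Run q (lookup ws j) (lookup σ j)) (unchanged p j j≢i) (run j)))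

        shorten : ∀ ws σ w → lookup ws i ≡ u ∷ w → Valid s (ws , σ) → Valid s′ (ws [ i ]≔ w , σ)
        shorten ws σ w wsᵢ≡ V@(valid run _ _) = valid-update {s} {s′} i V
          (unchanged p) (λ j j≢i → Vec.lookup∘update′ j≢i ws w)
          (≡.subst₂ (λ q w → Run q w (lookup σ i)) (≡.sym (updated p)) (≡.sym ws≡)
            (pred-run (≡.subst₂ (λ q w → Run q w (lookup σ i)) sᵢ≡ wsᵢ≡ (run i))))
          λ x∈ → inj₁ (old x∈)
          where
          ws≡ : lookup (ws [ i ]≔ w) i ≡ w
          ws≡ = Vec.lookup∘update i ws w
          old : ∀ {x} → x ∈ trace (lookup s′ i) (lookup (ws [ i ]≔ w) i) → x ∈ trace (lookup s i) (lookup ws i)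
          old x∈ rewrite ws≡ | updated p | sᵢ≡ | wsᵢ≡ = there x∈

        weight-extend : ∀ x → weight s (h x) ≈ moveWeight v u * weight s′ x
        weight-extend (ws , σ) = trans (*-congˡ (product-scaleAt i (moveWeight v u) off at)) (x*yz≈y*xz _ _ _)
          where
          off : ∀ j → j ≢ i → traceWeight (lookup s j) (lookup (updateAt ws i (u ∷_)) j) ≈
                              traceWeight (lookup s′ j) (lookup ws j)
          off j j≢i = reflexive (≡.cong₂ traceWeight (≡.sym (unchanged p j j≢i)) (Vec.lookup∘updateAt′ j i j≢i ws))
          at : traceWeight (lookup s i) (lookup (updateAt ws i (u ∷_)) i) ≈
               moveWeight v u * traceWeight (lookup s′ i) (lookup ws i)
          at rewrite Vec.lookup∘updateAt i {f = u ∷_} ws | sᵢ≡ | updated p = refl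

      -- Prepending `u` to word `i` is a bijection from the configurations valid after the move to
      -- those whose path `i` begins with `u`. The only vertex it adds is `v`, which is harmless by
      -- `fresh`.
      stepsBy-sum : HasSum (Valid s′) (weight s′) (det-states s′) →
                    HasSum (StepsBy u) (weight s) (moveWeight v u * substitute (row p))
      stepsBy-sum IH = hasSum-resp
        (λ (ws , σ) → mk⇔
          (λ { (x , V , ≡.refl) → extend x V , lookup (proj₁ x) i , Vec.lookup∘updateAt i (proj₁ x) })
          (λ (V , w , wsᵢ≡) → (ws [ i ]≔ w , σ) , shorten ws σ w wsᵢ≡ V ,
            ≡.cong (_, σ) (≡.trans (Vec.updateAt-updateAt i ws)
              (Vec.updateAt-id-local i ws (≡.sym wsᵢ≡)))))
        (*-congˡ (reflexive (det-substitute p)))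
        (hasSum-image (moveWeight v u) h-injective (λ {x} _ → weight-extend x) IH)

    module _ (k : Fin n) (halts : Run (active v) [] k)
             (target : ∀ {k′} → Run (active v) [] k′ → k′ ≡ k) where

      private
        p : State
        p = done k

        s′ : Vec State n
        s′ = s [ i ]≔ p

        to-halted : ∀ x → Valid s x → lookup (proj₁ x) i ≡ [] → Valid s′ x
        to-halted (ws , σ) V@(valid run _ _) wsᵢ≡ = valid-update {s} {s′} i V
          (unchanged p) (λ _ _ → ≡.refl)
          (≡.subst₂ (λ q w → Run q w (lookup σ i)) (≡.sym (updated p)) (≡.sym wsᵢ≡)
            (≡.subst (Run (done k) []) (≡.sym (target (≡.subst₂ (λ q w → Run q w (lookup σ i)) sᵢ≡ wsᵢ≡ (run i)))) stop))
          λ {x} x∈ → contradiction (≡.subst (λ q → x ∈ trace q (lookup ws i)) (updated p) x∈) λ ()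

        from-halted : ∀ x → Valid s′ x → Valid s x × lookup (proj₁ x) i ≡ []
        from-halted (ws , σ) V@(valid run _ _) = valid-update {s′} {s} i V
          (λ j j≢i → ≡.sym (unchanged p j j≢i)) (λ _ _ → ≡.refl)
          (≡.subst₂ (λ q w → Run q w (lookup σ i)) (≡.sym sᵢ≡) (≡.sym wsᵢ≡)
            (≡.subst (Run (active v) []) (≡.sym σᵢ≡) halts))
          new , wsᵢ≡
          where
          wsᵢ≡ : lookup ws i ≡ []
          wsᵢ≡ = proj₁ (unstop (updated p) (run i))
          σᵢ≡ : lookup σ i ≡ k
          σᵢ≡ = proj₂ (unstop (updated p) (run i))
          new : ∀ {x} → x ∈ trace (lookup s i) (lookup ws i) →
                x ∈ trace (lookup s′ i) (lookup ws i) ⊎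
                (∀ j → j ≢ i → x ∉ trace (lookup s′ j) (lookup ws j))
          new x∈ rewrite wsᵢ≡ | sᵢ≡ with x∈
          ... | here ≡.refl = inj₂ λ j j≢i → ≡.subst (λ q → v ∉ trace q (lookup ws j)) (≡.sym (unchanged p j j≢i))
                (fresh j≢i (≡.subst (λ q → Run q (lookup ws j) (lookup σ j)) (unchanged p j j≢i) (run j)))

        weight-halted : ∀ x → Valid s′ x → weight s x ≈ 1# * weight s′ x
        weight-halted (ws , σ) (valid run _ _) = trans (*-congˡ (product-scaleAt i 1# off at)) (x*yz≈y*xz _ _ _)
          where
          off : ∀ j → j ≢ i → traceWeight (lookup s j) (lookup ws j) ≈ traceWeight (lookup s′ j) (lookup ws j)
          off j j≢i = reflexive (≡.cong (λ q → traceWeight q (lookup ws j)) (≡.sym (unchanged p j j≢i)))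
          at : traceWeight (lookup s i) (lookup ws i) ≈ 1# * traceWeight (lookup s′ i) (lookup ws i)
          at rewrite proj₁ (unstop (updated p) (run i)) | sᵢ≡ | updated p = sym (*-identityˡ 1#)

      -- The configurations are literally the same on both sides; the state `done k` merely forgets
      -- the vertex `v`, and `fresh` lets it be restored.
      halts-sum : HasSum (Valid s′) (weight s′) (det-states s′) →
                  HasSum Halts (weight s) (substitute (row p))
      halts-sum IH = hasSum-resp
        (λ x → mk⇔ (λ { (x , V , ≡.refl) → from-halted x V }) (λ (V , wsᵢ≡) → x , to-halted x V wsᵢ≡ , ≡.refl))
        (trans (*-identityˡ _) (reflexive (det-substitute p)))
        (hasSum-image {h = id} 1# id (λ {x} → weight-halted x) IH)

    module _ (next : ∀ p → level p ℕ.< level (active v) →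
                     HasSum (Valid (s [ i ]≔ p)) (weight (s [ i ]≔ p)) (det-states (s [ i ]≔ p))) where

      private
        runᵢ : ∀ {x w} → Valid s x → lookup (proj₁ x) i ≡ w → Run (active v) w (lookup (proj₂ x) i)
        runᵢ {x} V e = ≡.subst₂ (λ q w → Run q w (lookup (proj₂ x) i)) sᵢ≡ e (Valid.run V i)

        none : ∀ {P : Configuration → Set} {f} → (∀ x → ¬ P x) → f ≋ 𝟎 → HasSum P (weight s) (substitute f)
        none ¬P f≋𝟎 = hasSum-resp (λ x → mk⇔ id id) (sym (vanish substitute-linear f≋𝟎)) (hasSum-∅ ¬P)

      halts-total : ∀ r y → v ≡ (r , y) → HasSum Halts (weight s) (substitute (halt-row r y))
      halts-total r (suc y) ≡.refl = none (λ x (V , e) → case runᵢ V e of λ ()) (λ _ → refl)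
      halts-total r zero    ≡.refl with Fin.any? (λ k → r ℕ.+ suc (toℕ k) ℕ.≟ n)
      ... | yes (k , r+1+k≡n) = hasSum-resp (λ x → mk⇔ id id) (cong⁺ substitute-linear unit≋)
            (halts-sum k (halt r+1+k≡n) ends (next (done k) (ℕ.s≤s ℕ.z≤n)))
        where
        ends : ∀ {k′} → Run (active (r , 0)) [] k′ → k′ ≡ k
        ends (halt eq) = Fin.toℕ-injective (ℕ.suc-injective (ℕ.+-cancelˡ-≡ r _ _ (≡.trans eq (≡.sym r+1+k≡n))))
        unit≋ : unit (toℕ k) ≋ halt-row r 0
        unit≋ k′ with toℕ k ℕ.≟ k′
        ... | yes ≡.refl rewrite r+1+k≡n = trans (unit-diagonal (toℕ k)) (sym (unit-diagonal n))
        ... | no  k≢k′   = trans (unit-offDiagonal k≢k′) (sym (unit-offDiagonal λ eq →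
              k≢k′ (ℕ.suc-injective (ℕ.+-cancelˡ-≡ r _ _ (≡.trans r+1+k≡n (≡.sym eq))))))
      -- The row must vanish in every column, also beyond `n`: a column `k` with `r + suc k ≡ n`
      -- satisfies k < n and would be a target.
      ... | no  noTarget = none (λ x (V , e) → case runᵢ V e of λ { (halt eq) → noTarget (_ , eq) })
            λ k → unit-offDiagonal λ eq → let k<n = ≡.subst (suc k ℕ.≤_) eq (ℕ.m≤n+m (suc k) r) in
              noTarget (fromℕ< k<n , ≡.trans (≡.cong (λ k → r ℕ.+ suc k) (Fin.toℕ-fromℕ< k<n)) eq)

      slides-total : ∀ r y → v ≡ (r , y) → HasSum (StepsBy down) (weight s) (substitute (slide-row r y))
      slides-total r zero    ≡.refl = none (λ x (V , w , e) → case runᵢ V e of λ ()) (λ _ → refl)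
      slides-total r (suc y) ≡.refl = hasSum-resp (λ x → mk⇔ id id)
        (sym (scale substitute-linear (c (line r)) (active-row r y)))
        (stepsBy-sum down (λ { (slide ρ) → ρ }) slide (next (active (r , y)) (level-slide r y)))

      jumps-total : ∀ r y → v ≡ (r , y) →
                    HasSum (λ x → ∃[ k ] StepsBy (a k) x) (weight s) (substitute (jump-row r y))
      jumps-total zero    y ≡.refl = none (λ x (k , V , w , e) → case runᵢ V e of λ ()) (λ _ → refl)
      jumps-total (suc r) y ≡.refl = hasSum-resp (λ x → mk⇔ id id)
        (sym (linear-sum substitute-linear {suc ℓ} (λ k → b k (line (suc r))) (λ k → active-row r (y ℕ.+ (ℓ ∸ toℕ k)))))
        (hasSum-∃ (λ { (_ , _ , e) (_ , _ , e′) → same-step (≡.trans (≡.sym e) e′) })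
          λ k → stepsBy-sum (a k) (λ { (jump ρ) → ρ }) jump (next _ (level-jump r y k)))
        where
        same-step : ∀ {k k′ : Fin (suc ℓ)} {w w′ : Word} → a k List.∷ w ≡ a k′ List.∷ w′ → k ≡ k′
        same-step ≡.refl = ≡.refl

      step-total : HasSum (Valid s) (weight s) (det-states s)
      step-total = hasSum-resp
        (λ x → mk⇔ [ proj₁ , [ proj₁ , proj₁ ∘ proj₂ ]′ ]′ (classify x)) expansion
        (hasSum-⊎ (λ { (_ , e) (inj₁ (_ , _ , e′)) → contradiction (≡.trans (≡.sym e) e′) λ ()
                     ; (_ , e) (inj₂ (_ , _ , _ , e′)) → contradiction (≡.trans (≡.sym e) e′) λ () })
          (halts-total r₀ y₀ ≡.refl)
          (hasSum-⊎ (λ { (_ , _ , e) (_ , _ , _ , e′) → contradiction (≡.trans (≡.sym e) e′) λ () })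
            (slides-total r₀ y₀ ≡.refl) (jumps-total r₀ y₀ ≡.refl)))
        where
        open Σ v renaming (proj₁ to r₀; proj₂ to y₀)

        expansion : substitute (halt-row r₀ y₀) + (substitute (slide-row r₀ y₀) + substitute (jump-row r₀ y₀)) ≈ det-states s
        expansion = begin
          substitute (halt-row r₀ y₀) + (substitute (slide-row r₀ y₀) + substitute (jump-row r₀ y₀))
            ≈⟨ +-congˡ (add substitute-linear (slide-row r₀ y₀) (jump-row r₀ y₀)) ⟨
          substitute (halt-row r₀ y₀) + substitute (slide-row r₀ y₀ ⊹ jump-row r₀ y₀)
            ≈⟨ add substitute-linear (halt-row r₀ y₀) (slide-row r₀ y₀ ⊹ jump-row r₀ y₀) ⟨
          substitute (row (active v))         ≡⟨ ≡.cong (substitute ∘ row) sᵢ≡ ⟨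
          substitute (row (lookup s i))       ≡⟨ ≡.cong substitute (Vec.lookup-map i row s) ⟨
          substitute (lookup (map row s) i)   ≡⟨ ≡.cong (det n 0) (Vec.[]≔-lookup (map row s) i) ⟩
          det-states s                        ∎

        classify : ∀ x → Valid s x → Halts x ⊎ StepsBy down x ⊎ (∃[ k ] StepsBy (a k) x)
        classify (ws , σ) V with lookup ws i
        ... | []       = inj₁ (V , ≡.refl)
        ... | down ∷ w = inj₂ (inj₁ (V , w , ≡.refl))
        ... | a k ∷ w  = inj₂ (inj₂ (k , V , w , ≡.refl))

  -- An active path of maximal level takes its first step without meeting the other
  -- paths, since levels decrease along runs; so both sides satisfy the same recurrence.
  lgv : ∀ s → HasSum (Valid s) (weight s) (det-states s)
  lgv s = go s (<-wellFounded (size s))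
    where
    size : Vec State n → ℕ
    size s = Vec.sum (map level s)

    go : ∀ s → Acc ℕ._<_ (size s) → HasSum (Valid s) (weight s) (det-states s)
    go s (acc rec) with maximal s
    ... | inj₁ (q , ≡.refl) = all-done q
    ... | inj₂ (i , v , sᵢ≡ , max) with Fin.any? (λ j → ¬? (j Fin.≟ i) ×-dec isActive? (lookup s j) v)
    ...   | yes (j , j≢i , sⱼ≡) = collision j≢i sᵢ≡ sⱼ≡
    ...   | no  alone = Advance.step-total s i v sᵢ≡ max (λ j j≢i sⱼ≡ → alone (j , j≢i , sⱼ≡))
      λ p lt → go _ (rec (sum-map-[]≔-< level s i (≡.subst (λ q → level p ℕ.< level q) (≡.sym sᵢ≡) lt)))

-- Evaluation of the determinant by Newton polynomials

module Evaluation {r e} (R : CommutativeRing r e) (ℓ : ℕ)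
               (b : Fin (suc ℓ) → ℤ → CommutativeRing.Carrier R)
               (c : ℤ → CommutativeRing.Carrier R) (n : ℕ) where
  open CommutativeRing R hiding (zero)
  open import Algebra.Properties.Semiring.Exp semiring using (_^_; ^-homo-*)
  open import Algebra.Properties.Semiring.Sum semiring using (sum; sum-cong-≋; *-distribˡ-sum; *-distribʳ-sum; ∑-distrib-+)
  open import Algebra.Properties.CommutativeSemigroup *-commutativeSemigroup
    using () renaming (x∙yz≈y∙xz to x*yz≈y*xz)
  open Determinant R
  open Lattice R ℓ b c n
  open import Relation.Binary.Reasoning.Setoid setoid hiding (stop)

  sum-zero : ∀ {m} {f : Fin m → Carrier} → (∀ i → f i ≈ 0#) → sum f ≈ 0#
  sum-zero {zero}  f≈0 = refl
  sum-zero {suc m} f≈0 = trans (+-cong (f≈0 zero) (sum-zero (f≈0 ∘ suc))) (+-identityʳ 0#)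

  -- A sequence F stands for the linear functional on polynomials with F y its value
  -- at z ^ y, and operators on sequences for multiplication by a polynomial.
  Sequence : Set r
  Sequence = ℕ → Carrier

  shift : ℕ → Sequence → Sequence
  shift j F y = F (j ℕ.+ y)

  factor : Carrier → Sequence → Sequence
  factor w F y = F (suc y) + (- w) * F y

  jumps : ℤ → Sequence → Sequence
  jumps j F y = sum λ i → b i j * F (y ℕ.+ (ℓ ∸ toℕ i))

  -- Multiplication by (z - c_{j+1})⋯(z - c_{j+i}).
  factors : ℕ → ℕ → Sequence → Sequence
  factors j zero    F = F
  factors j (suc i) F = factors (suc j) i (factor (c (+ suc j)) F)

  allJumps : ℕ → Sequence → Sequence
  allJumps zero    F = F
  allJumps (suc j) F = allJumps j (jumps (+ j) F)

  factor-cong : ∀ w {F G} → F ≋ G → factor w F ≋ factor w G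
  factor-cong w F≋G y = +-cong (F≋G (suc y)) (*-congˡ (F≋G y))

  jumps-cong : ∀ j {F G} → F ≋ G → jumps j F ≋ jumps j G
  jumps-cong j F≋G y = sum-cong-≋ {suc ℓ} λ i → *-congˡ {b i j} (F≋G (y ℕ.+ (ℓ ∸ toℕ i)))

  factors-cong : ∀ j i {F G} → F ≋ G → factors j i F ≋ factors j i G
  factors-cong j zero    F≋G = F≋G
  factors-cong j (suc i) F≋G = factors-cong (suc j) i (factor-cong _ F≋G)

  allJumps-cong : ∀ j {F G} → F ≋ G → allJumps j F ≋ allJumps j G
  allJumps-cong zero    F≋G = F≋G
  allJumps-cong (suc j) F≋G = allJumps-cong j (jumps-cong (+ j) F≋G)

  factors-zero : ∀ j i {F} → F ≋ 𝟎 → factors j i F ≋ 𝟎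
  factors-zero j zero    F≋𝟎 = F≋𝟎
  factors-zero j (suc i) F≋𝟎 = factors-zero (suc j) i λ y →
    trans (+-cong (F≋𝟎 (suc y)) (trans (*-congˡ (F≋𝟎 y)) (zeroʳ _))) (+-identityʳ 0#)

  allJumps-zero : ∀ j {F} → F ≋ 𝟎 → allJumps j F ≋ 𝟎
  allJumps-zero zero    F≋𝟎 = F≋𝟎
  allJumps-zero (suc j) F≋𝟎 = allJumps-zero j λ y → sum-zero {suc ℓ} λ i →
    trans (*-congˡ (F≋𝟎 (y ℕ.+ (ℓ ∸ toℕ i)))) (zeroʳ (b i (+ j)))

  factor-jumps : ∀ w j F → factor w (jumps j F) ≋ jumps j (factor w F)
  factor-jumps w j F y = begin
    sum (λ i → b i j * F (suc y ℕ.+ (ℓ ∸ toℕ i))) + (- w) * sum (λ i → b i j * F (y ℕ.+ (ℓ ∸ toℕ i)))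
      ≈⟨ +-congˡ (trans (*-distribˡ-sum {suc ℓ} (- w) (λ i → b i j * F (y ℕ.+ (ℓ ∸ toℕ i))))
                         (sum-cong-≋ {suc ℓ} λ i → x*yz≈y*xz (- w) (b i j) (F (y ℕ.+ (ℓ ∸ toℕ i))))) ⟩
    sum (λ i → b i j * F (suc y ℕ.+ (ℓ ∸ toℕ i))) + sum (λ i → b i j * ((- w) * F (y ℕ.+ (ℓ ∸ toℕ i))))
      ≈⟨ ∑-distrib-+ {suc ℓ} (λ i → b i j * F (suc y ℕ.+ (ℓ ∸ toℕ i)))
                                (λ i → b i j * ((- w) * F (y ℕ.+ (ℓ ∸ toℕ i)))) ⟨
    sum (λ i → b i j * F (suc y ℕ.+ (ℓ ∸ toℕ i)) + b i j * ((- w) * F (y ℕ.+ (ℓ ∸ toℕ i))))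
      ≈⟨ sum-cong-≋ {suc ℓ} (λ i → sym (distribˡ (b i j) (F (suc y ℕ.+ (ℓ ∸ toℕ i))) ((- w) * F (y ℕ.+ (ℓ ∸ toℕ i))))) ⟩
    jumps j (factor w F) y ∎

  factor-allJumps : ∀ w j F → factor w (allJumps j F) ≋ allJumps j (factor w F)
  factor-allJumps w zero    F y = refl
  factor-allJumps w (suc j) F y = trans (factor-allJumps w j (jumps (+ j) F) y)
                                        (allJumps-cong j (factor-jumps w (+ j) F) y)

  factor-shift : ∀ w j F → factor w (shift j F) ≋ shift j (factor w F)
  factor-shift w j F y = +-congʳ (reflexive (≡.cong F (ℕ.+-suc j y)))

  shift-jumps : ∀ i j F → shift i (jumps j F) ≋ jumps j (shift i F)
  shift-jumps i j F y = sum-cong-≋ {suc ℓ} λ l → *-congˡ {b l j} (reflexive (≡.cong F (ℕ.+-assoc i y (ℓ ∸ toℕ l))))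

  jumpPolynomial : ℤ → Carrier → Carrier
  jumpPolynomial t w = sum λ i → b i t * w ^ (ℓ ∸ toℕ i)

  -- A geometric sequence is a multiple of evaluation at `w`, and for evaluation at `w`, multiplying
  -- the argument by a polynomial means multiplying the result by its value at `w`.
  jumps-geometric : ∀ j w x {F} → (∀ y → F y ≈ x * w ^ y) → ∀ y → jumps j F y ≈ (jumpPolynomial j w * x) * w ^ y
  jumps-geometric j w x {F} F≈ y = begin
    sum (λ i → b i j * F (y ℕ.+ (ℓ ∸ toℕ i)))
      ≈⟨ sum-cong-≋ {suc ℓ} (λ i → trans (*-congˡ (trans (F≈ (y ℕ.+ (ℓ ∸ toℕ i))) (*-congˡ (^-homo-* w y (ℓ ∸ toℕ i)))))
                                 (regroup (b i j) x (w ^ y) (w ^ (ℓ ∸ toℕ i)))) ⟩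
    sum (λ i → (b i j * w ^ (ℓ ∸ toℕ i)) * (x * w ^ y))
      ≈⟨ *-distribʳ-sum {suc ℓ} (x * w ^ y) (λ i → b i j * w ^ (ℓ ∸ toℕ i)) ⟨
    jumpPolynomial j w * (x * w ^ y)                     ≈⟨ *-assoc _ _ _ ⟨
    (jumpPolynomial j w * x) * w ^ y                     ∎
    where
    regroup : ∀ p x u v → p * (x * (u * v)) ≈ (p * v) * (x * u)
    regroup p x u v = trans (*-congˡ (trans (sym (*-assoc x u v)) (*-comm _ v))) (sym (*-assoc p v _))

  allJumps-geometric : ∀ j w x {F} → (∀ y → F y ≈ x * w ^ y) → ∀ y →
                       allJumps j F y ≈ (productFrom (λ t → jumpPolynomial (+ t) w) 0 j * x) * w ^ y
  allJumps-geometric zero    w x F≈ y = trans (F≈ y) (*-congʳ (sym (*-identityˡ x)))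
  allJumps-geometric (suc j) w x F≈ y =
    trans (allJumps-geometric j w (jumpPolynomial (+ j) w * x) (jumps-geometric (+ j) w x F≈) y)
          (*-congʳ (trans (x*yz≈y*xz _ _ _) (trans (sym (*-assoc _ _ _))
            (*-congʳ (sym (productFrom-last (λ t → jumpPolynomial (+ t) w) 0 j))))))

  line≡ : ∀ r j → r ℕ.+ j ≡ n → line r ≡ + j
  line≡ r j eq = ≡.trans (ℤ.m-n≡m⊖n n r) (≡.trans (ℤ.⊖-≥ (≡.subst (r ℕ.≤_) eq (ℕ.m≤m+n r j)))
    (≡.cong +_ (≡.trans (≡.cong (_∸ r) (≡.sym eq)) (ℕ.m+n∸m≡n r j))))

  column : ℕ → ℕ → Sequence
  column k r y = active-row r y k

  halt-row-zero : ∀ {r k} → r ℕ.+ suc k ≢ n → ∀ y → halt-row r y k ≈ 0#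
  halt-row-zero r+1+k≢n zero    = unit-offDiagonal r+1+k≢n
  halt-row-zero r+1+k≢n (suc y) = refl

  0+[0+0] : ∀ {x y z} → x ≈ 0# → y ≈ 0# → z ≈ 0# → x + (y + z) ≈ 0#
  0+[0+0] x≈0 y≈0 z≈0 = trans (+-cong x≈0 (trans (+-cong y≈0 z≈0) (+-identityʳ 0#))) (+-identityʳ 0#)

  mutual
    -- These lines lie past target `k`, and no step leads back to an earlier line. In the companion
    -- statement equality is allowed, because a jump from the line of the target already overshoots
    -- it.
    column-beyond : ∀ {k} r y → r ℕ.+ suc k ℕ.< n → column k r y ≈ 0#
    column-beyond r zero    lt = 0+[0+0] (halt-row-zero (ℕ.<⇒≢ lt) 0) refl (jump-row-beyond r 0 (ℕ.<⇒≤ lt))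
    column-beyond r (suc y) lt = 0+[0+0] refl (trans (*-congˡ (column-beyond r y lt)) (zeroʳ _))
                                         (jump-row-beyond r (suc y) (ℕ.<⇒≤ lt))

    jump-row-beyond : ∀ {k} r y → r ℕ.+ suc k ℕ.≤ n → jump-row r y k ≈ 0#
    jump-row-beyond zero    y le = refl
    jump-row-beyond (suc r) y le = sum-zero {suc ℓ} λ i →
      trans (*-congˡ (column-beyond r (y ℕ.+ (ℓ ∸ toℕ i)) le)) (zeroʳ (b i (line (suc r))))

  -- On its own line the target is reached by down steps alone. The functional of that line is
  -- therefore evaluation at c_{k+1}.
  column-target : ∀ {k} r → r ℕ.+ suc k ≡ n → ∀ y → column k r y ≈ c (line r) ^ y
  column-target {k} r eq zero = begin
    unit (r ℕ.+ suc k) n + (0# + jump-row r 0 k)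
      ≈⟨ +-cong (trans (reflexive (≡.cong (λ m → unit m n) eq)) (unit-diagonal n))
                (trans (+-identityˡ _) (jump-row-beyond r 0 (ℕ.≤-reflexive eq))) ⟩
    1# + 0#  ≈⟨ +-identityʳ 1# ⟩
    1#       ∎
  column-target {k} r eq (suc y) = begin
    0# + (c (line r) * column k r y + jump-row r (suc y) k)
      ≈⟨ trans (+-identityˡ _) (+-cong (*-congˡ (column-target r eq y)) (jump-row-beyond r (suc y) (ℕ.≤-reflexive eq))) ⟩
    c (line r) * c (line r) ^ y + 0#  ≈⟨ +-identityʳ _ ⟩
    c (line r) ^ suc y                ∎

  -- Halts occur at ordinate 0 only and are absent at `suc y`; subtracting the multiple of
  -- `column k r y` removes the slides. The jumps from `suc y`, and not from `y`, account for the
  -- extra factor z.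
  factor-column : ∀ k r y → factor (c (line r)) (column k r) y ≈ jump-row r (suc y) k
  factor-column k r y = begin
    0# + (w * x + z) + (- w) * x  ≈⟨ +-cong (trans (+-identityˡ _) (+-comm _ _)) (sym (-‿distribˡ-* w x)) ⟩
    z + w * x + - (w * x)         ≈⟨ +-assoc _ _ _ ⟩
    z + (w * x + - (w * x))       ≈⟨ +-congˡ (-‿inverseʳ _) ⟩
    z + 0#                        ≈⟨ +-identityʳ _ ⟩
    z                             ∎
    where
    open import Algebra.Properties.Ring ring using (-‿distribˡ-*)
    w x z : Carrier
    w = c (line r)
    x = column k r y
    z = jump-row r (suc y) k

  stage : ℕ → ℕ → ℕ → Sequence
  stage j k r = allJumps (suc j) (shift j (column k r))

  factor-stage : ∀ j k r → r ℕ.+ suc j ≡ n →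
                 factor (c (+ suc j)) (stage j k r) ≋ allJumps (suc j) (shift j (λ y → jump-row r (suc y) k))
  factor-stage j k r eq y = begin
    factor (c (+ suc j)) (stage j k r) y
      ≈⟨ factor-allJumps (c (+ suc j)) (suc j) (shift j (column k r)) y ⟩
    allJumps (suc j) (factor (c (+ suc j)) (shift j (column k r))) y
      ≈⟨ allJumps-cong (suc j) (λ y → trans (factor-shift (c (+ suc j)) j (column k r) y)
           (trans (reflexive (≡.cong (λ i → factor (c i) (column k r) (j ℕ.+ y)) (≡.sym (line≡ r (suc j) eq))))
                  (factor-column k r (j ℕ.+ y)))) y ⟩
    allJumps (suc j) (shift j (λ y → jump-row r (suc y) k)) y ∎

  factor-stage-suc : ∀ j k r → suc r ℕ.+ suc j ≡ n → factor (c (+ suc j)) (stage j k (suc r)) ≋ stage (suc j) k r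
  factor-stage-suc j k r eq y = trans (factor-stage j k (suc r) eq y) (allJumps-cong (suc j)
    (λ y → trans (reflexive (≡.cong (λ t → jumps t (column k r) (suc j ℕ.+ y)) (line≡ (suc r) (suc j) eq)))
                 (shift-jumps (suc j) (+ suc j) (column k r) y)) y)

  remaining-lines : ∀ m ρ j {k} → j ℕ.+ suc m ≡ k → ρ ℕ.+ suc k ≡ n → suc (m ℕ.+ ρ) ℕ.+ suc j ≡ n
  remaining-lines m ρ j ≡.refl eqn = ≡.trans (rearrange m ρ j) eqn
    where
    rearrange : ∀ m ρ j → suc (m ℕ.+ ρ) ℕ.+ suc j ≡ ρ ℕ.+ suc (j ℕ.+ suc m)
    rearrange = ℕ-Solver.solve-∀

  -- Each of the `m` factors moves the functional on by one line, up to line k + 1 of the target.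
  -- There it is evaluation at c_{k+1}, applied to z^k times the jump polynomials collected on the
  -- way.
  stage-diagonal : ∀ m j k ρ → j ℕ.+ m ≡ k → ρ ℕ.+ suc k ≡ n →
    factors j m (stage j k (m ℕ.+ ρ)) 0 ≈ productFrom (λ t → jumpPolynomial (+ t) (c (+ suc k))) 0 (suc k) * c (+ suc k) ^ k
  stage-diagonal zero j k ρ eq eqn rewrite ≡.trans (≡.sym (ℕ.+-identityʳ j)) eq = begin
    allJumps (suc k) (shift k (column k ρ)) 0
      ≈⟨ allJumps-geometric (suc k) w (w ^ k) geometric 0 ⟩
    productFrom (λ t → jumpPolynomial (+ t) w) 0 (suc k) * w ^ k * 1#  ≈⟨ *-identityʳ _ ⟩
    productFrom (λ t → jumpPolynomial (+ t) w) 0 (suc k) * w ^ k       ∎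
    where
    w : Carrier
    w = c (+ suc k)
    geometric : ∀ y → column k ρ (k ℕ.+ y) ≈ w ^ k * w ^ y
    geometric y = trans (column-target ρ eqn (k ℕ.+ y))
      (trans (reflexive (≡.cong (λ i → c i ^ (k ℕ.+ y)) (line≡ ρ (suc k) eqn))) (^-homo-* w k y))
  stage-diagonal (suc m) j k ρ eq eqn =
    trans (factors-cong (suc j) m (factor-stage-suc j k (m ℕ.+ ρ) (remaining-lines m ρ j eq eqn)) 0)
          (stage-diagonal m (suc j) k ρ (≡.trans (≡.sym (ℕ.+-suc j m)) eq) eqn)

  -- After `m` factors the line of the target is reached, and the next factor, z - c_{k+1},
  -- annihilates evaluation at c_{k+1}.
  stage-lower : ∀ m i j k ρ → j ℕ.+ m ≡ k → ρ ℕ.+ suc k ≡ n →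
    factors j (m ℕ.+ suc i) (stage j k (m ℕ.+ ρ)) ≋ 𝟎
  stage-lower zero i j k ρ eq eqn rewrite ≡.trans (≡.sym (ℕ.+-identityʳ j)) eq = factors-zero (suc k) i
    λ y → trans (factor-stage k k ρ eqn y)
                (allJumps-zero (suc k) (λ y → jump-row-beyond ρ (suc (k ℕ.+ y)) (ℕ.≤-reflexive eqn)) y)
  stage-lower (suc m) i j k ρ eq eqn y =
    trans (factors-cong (suc j) (m ℕ.+ suc i) (factor-stage-suc j k (m ℕ.+ ρ) (remaining-lines m ρ j eq eqn)) y)
          (stage-lower m i (suc j) k ρ (≡.trans (≡.sym (ℕ.+-suc j m)) eq) eqn y)

  basisRow : ℕ → Row
  basisRow y = jump-row n y

  -- Every factor is monic of degree one: it raises the leading index by one and preserves the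
  -- leading coefficient.
  leading-factors : ∀ i j s (F : ℕ → Row) → (∀ y → Leading basisRow (s ℕ.+ y) 1# (F y)) →
                    ∀ y → Leading basisRow (i ℕ.+ s ℕ.+ y) 1# (λ k → factors j i (λ y → F y k) y)
  leading-factors zero    j s F lead y = lead y
  leading-factors (suc i) j s F lead y =
    ≡.subst (λ m → Leading basisRow (m ℕ.+ y) 1# (λ k → factors j (suc i) (λ y → F y k) y)) (ℕ.+-suc i s)
      (leading-factors i (suc j) (suc s) (λ y → F (suc y) ⊹ ((- c (+ suc j)) ∙ F y))
        (λ y → leading-plus (≡.subst (λ m → Leading basisRow m 1# (F (suc y))) (ℕ.+-suc s y) (lead (suc y)))
                            (scaled _ (leading-below (lead y))))
        y)

  -- The functionals of all targets applied to the Newton polynomial of degree `i`; the final `0` is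
  -- the exponent in z^0 = 1.
  newtonRow : ℕ → Row
  newtonRow i k = factors 0 i (λ y → jump-row n y k) 0

  newtonRow-leading : ∀ i → Leading basisRow i 1# (newtonRow i)
  newtonRow-leading i = ≡.subst (λ m → Leading basisRow m 1# (newtonRow i))
    (≡.trans (ℕ.+-identityʳ _) (ℕ.+-identityʳ i)) (leading-factors i 0 0 basisRow leading-basis 0)

  jump-row-stage : ∀ k r → suc r ≡ n → ∀ y → jump-row n y k ≈ stage 0 k r y
  jump-row-stage k r 1+r≡n y = begin
    jump-row n y k            ≡⟨ ≡.cong (λ m → jump-row m y k) 1+r≡n ⟨
    jump-row (suc r) y k      ≡⟨ ≡.cong (λ t → jumps t (column k r) y)
                                   (line≡ (suc r) 0 (≡.trans (ℕ.+-identityʳ _) 1+r≡n)) ⟩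
    stage 0 k r y             ∎

  newtonRow-diagonal : ∀ k → k ℕ.< n → newtonRow k k ≈
    productFrom (λ t → jumpPolynomial (+ t) (c (+ suc k))) 0 (suc k) * c (+ suc k) ^ k
  newtonRow-diagonal k k<n = trans
    (factors-cong 0 k (jump-row-stage k (k ℕ.+ ρ) (≡.trans (ℕ.+-comm (suc k) ρ) eq)) 0)
    (stage-diagonal k 0 k ρ ≡.refl eq)
    where
    ρ = n ∸ suc k
    eq : ρ ℕ.+ suc k ≡ n
    eq = ℕ.m∸n+n≡m k<n

  newtonRow-lower : ∀ {i k} → k ℕ.< i → i ℕ.< n → newtonRow i k ≈ 0#
  newtonRow-lower {i} {k} k<i i<n = trans
    (factors-cong 0 i (jump-row-stage k (k ℕ.+ ρ) (≡.trans (ℕ.+-comm (suc k) ρ) eq)) 0)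
    (≡.subst (λ m → factors 0 m (stage 0 k (k ℕ.+ ρ)) 0 ≈ 0#) i≡ (stage-lower k (i ∸ suc k) 0 k ρ ≡.refl eq 0))
    where
    ρ = n ∸ suc k
    eq : ρ ℕ.+ suc k ≡ n
    eq = ℕ.m∸n+n≡m (ℕ.<-trans k<i i<n)
    i≡ : k ℕ.+ suc (i ∸ suc k) ≡ i
    i≡ = ≡.trans (ℕ.+-suc k _) (ℕ.m+[n∸m]≡n k<i)

  climbWeight : ℕ → Carrier
  climbWeight d = productFrom (λ j → b zero (ℤ.- + j)) 1 d

  line-above : ∀ d → line (suc d ℕ.+ n) ≡ ℤ.- + suc d
  line-above d = ≡.trans (ℤ.m-n≡m⊖n n (suc d ℕ.+ n)) (≡.trans (ℤ.⊖-≤ (ℕ.m≤n+m n (suc d)))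
    (≡.cong (λ m → ℤ.- + m) (ℕ.m+n∸n≡m (suc d) n)))

  active-row-above : ∀ d y → jump-row (d ℕ.+ n) y ⊹ slide-row (d ℕ.+ n) y ≋ active-row (d ℕ.+ n) y
  active-row-above d y k = sym (trans
    (+-congʳ (halt-row-zero (λ eq → ℕ.<⇒≢ (ℕ.≤-<-trans (ℕ.m≤n+m n d) (ℕ.m<m+n (d ℕ.+ n) ℕ.z<s)) (≡.sym eq)) y))
    (trans (+-identityˡ _) (+-comm _ _)))

  mutual
    active-row-leading : ∀ d y → Leading basisRow (d ℕ.* ℓ ℕ.+ y) (climbWeight d) (active-row (d ℕ.+ n) y)
    active-row-leading d y =
      leading-resp (active-row-above d y) (leading-plus (jump-row-leading d y) (slide-row-below d y))

    slide-row-below : ∀ d y → Below basisRow (d ℕ.* ℓ ℕ.+ y) (slide-row (d ℕ.+ n) y)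
    slide-row-below d zero    = null
    slide-row-below d (suc y) = scaled _ (≡.subst (λ m → Below basisRow m (active-row (d ℕ.+ n) y))
      (≡.sym (ℕ.+-suc (d ℕ.* ℓ) y)) (leading-below (active-row-leading d y)))

    jump-row-leading : ∀ d y → Leading basisRow (d ℕ.* ℓ ℕ.+ y) (climbWeight d) (jump-row (d ℕ.+ n) y)
    jump-row-leading zero    y = leading-basis y
    jump-row-leading (suc d) y = leading-cong
      (trans (*-congʳ (reflexive (≡.cong (b zero) (line-above d))))
             (sym (productFrom-last (λ j → b zero (ℤ.- + j)) 1 d)))
      (leading-plus
        (leading-scaled _ (≡.subst (λ m → Leading basisRow m (climbWeight d) (active-row (d ℕ.+ n) (y ℕ.+ ℓ)))
                                   (rearrange d ℓ y) (active-row-leading d (y ℕ.+ ℓ))))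
        (below-sum _ λ i → below-mono (lower i) (leading-below (active-row-leading d (y ℕ.+ (ℓ ∸ suc (toℕ i)))))))
      where
      rearrange : ∀ d ℓ y → d ℕ.* ℓ ℕ.+ (y ℕ.+ ℓ) ≡ suc d ℕ.* ℓ ℕ.+ y
      rearrange = ℕ-Solver.solve-∀
      lower : ∀ (i : Fin ℓ) → suc (d ℕ.* ℓ ℕ.+ (y ℕ.+ (ℓ ∸ suc (toℕ i)))) ℕ.≤ suc d ℕ.* ℓ ℕ.+ y
      lower i = ≡.subst (suc (d ℕ.* ℓ ℕ.+ (y ℕ.+ (ℓ ∸ suc (toℕ i)))) ℕ.≤_) (rearrange d ℓ y)
        (ℕ.+-monoʳ-< (d ℕ.* ℓ) (ℕ.+-monoʳ-< y (ℕ.∸-monoʳ-< ℕ.z<s (Fin.toℕ<n i))))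

  module _ .{{_ : ℕ.NonZero ℓ}} where
    -- For source `i` the sum x + y is -i + (i mod ℓ) = -⌊i/ℓ⌋ ℓ, so it lies on line -⌊i/ℓ⌋.
    sourceVertex : ℕ → Vertex
    sourceVertex i = i ℕ./ ℓ ℕ.+ n , i ℕ.% ℓ

    sourceRow : ℕ → Row
    sourceRow i = row (active (sourceVertex i))

    sourceRow-leading : ∀ i → Leading basisRow i (climbWeight (i ℕ./ ℓ)) (sourceRow i)
    sourceRow-leading i = ≡.subst (λ m → Leading basisRow m (climbWeight (i ℕ./ ℓ)) (sourceRow i))
      (≡.trans (ℕ.+-comm _ (i ℕ.% ℓ)) (≡.sym (m≡m%n+[m/n]*n i ℓ))) (active-row-leading (i ℕ./ ℓ) (i ℕ.% ℓ))

    det-sources : det n 0 (rowsFrom sourceRow 0 n) ≈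
      productFrom (λ i → climbWeight (i ℕ./ ℓ)) 0 n *
      productFrom (λ k → productFrom (λ t → jumpPolynomial (+ t) (c (+ suc k))) 0 (suc k) * c (+ suc k) ^ k) 0 n
    det-sources = begin
      det n 0 (rowsFrom sourceRow 0 n)
        ≈⟨ alternating-leading (det-alternating n 0) 0 sourceRow-leading (λ ()) ⟩
      climbs * det n 0 (rowsFrom basisRow 0 n)
        -- The inserted product consists of the leading coefficients 1 of the Newton rows, so that
        -- the change from basis rows to Newton rows can be read backwards.
        ≈⟨ *-congˡ (trans (*-congʳ (productFrom-one 0 n)) (*-identityˡ _)) ⟨
      climbs * (productFrom (λ _ → 1#) 0 n * det n 0 (rowsFrom basisRow 0 n))
        ≈⟨ *-congˡ (alternating-leading (det-alternating n 0) 0 newtonRow-leading (λ ())) ⟨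
      climbs * det n 0 (rowsFrom newtonRow 0 n)
        ≈⟨ *-congˡ (trans (det-upperTriangular n 0 newtonRow newtonRow-lower)
                          (productFrom-cong 0 n λ k _ k<n → newtonRow-diagonal k k<n)) ⟩
      climbs * productFrom (λ k → productFrom (λ t → jumpPolynomial (+ t) (c (+ suc k))) 0 (suc k) * c (+ suc k) ^ k) 0 n ∎
      where
      climbs : Carrier
      climbs = productFrom (λ i → climbWeight (i ℕ./ ℓ)) 0 n

-- From paths in the plane to runs

open import Data.Integer.Base using (-_)

[j*ℓ]/ℕℓ≡j : ∀ j ℓ .{{_ : NonZero ℓ}} → (j ℤ.* + ℓ) /ℕ ℓ ≡ j
[j*ℓ]/ℕℓ≡j (+ m) ℓ = ≡.trans (≡.cong (_/ℕ ℓ) (≡.sym (ℤ.pos-* m ℓ))) (≡.cong +_ (m*n/n≡m m ℓ))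
[j*ℓ]/ℕℓ≡j -[1+ m ] (suc l) {{nz}} rewrite m*n%n≡0 (suc m) (suc l) {{nz}} | m*n/n≡m (suc m) (suc l) {{nz}} = ≡.refl

+[m∸n] : ∀ {m n} → n ℕ.≤ m → + (m ∸ n) ≡ + m ℤ.- + n
+[m∸n] {m} {n} n≤m = ≡.trans (≡.sym (ℤ.⊖-≥ n≤m)) (≡.sym (ℤ.m-n≡m⊖n m n))

module Translation {r e} (R : CommutativeRing r e) (ℓ : ℕ) .{{_ : NonZero ℓ}}
                   (b : Fin (suc ℓ) → ℤ → CommutativeRing.Carrier R)
                   (c : ℤ → CommutativeRing.Carrier R) (n : ℕ) where
  open CommutativeRing R hiding (zero; -_)
  open import Algebra.Properties.Monoid.Sum *-monoid using () renaming (sum-cong-≋ to product-cong)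
  open RingNotation R using (_^_; product)
  open Weight R ℓ b c
  open Determinant R
  open Summation R
  open Lattice R ℓ b c n
  open Evaluation R ℓ b c n using (sourceVertex; sourceRow; det-sources)

  point : Vertex → Point
  point (r , y) = line r ℤ.* + ℓ ℤ.- + y , + y

  diagonal : Point → ℤ
  diagonal (x , y) = x ℤ.+ y

  diagonal-point : ∀ r y → diagonal (point (r , y)) ≡ line r ℤ.* + ℓ
  diagonal-point r y = eq (line r ℤ.* + ℓ) (+ y)
    where
    eq : ∀ u y → u ℤ.- y ℤ.+ y ≡ u
    eq = ℤ-Solver.solve-∀

  diagonal-⊕ : ∀ p q → diagonal (p ⊕ q) ≡ diagonal p ℤ.+ diagonal q
  diagonal-⊕ (x , y) (x′ , y′) = eq x y x′ y′
    where
    eq : ∀ x y x′ y′ → (x ℤ.+ x′) ℤ.+ (y ℤ.+ y′) ≡ (x ℤ.+ y) ℤ.+ (x′ ℤ.+ y′)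
    eq = ℤ-Solver.solve-∀

  diagonal-a : ∀ i → diagonal (vector {ℓ} (a i)) ≡ + ℓ
  diagonal-a i = eq (+ toℕ i) (+ ℓ)
    where
    eq : ∀ i l → i ℤ.+ (l ℤ.- i) ≡ l
    eq = ℤ-Solver.solve-∀

  diagonal-vector : ∀ (u : Step ℓ) → 0ℤ ℤ.≤ diagonal (vector u)
  diagonal-vector (a i) = ≡.subst (0ℤ ℤ.≤_) (≡.sym (diagonal-a i)) (ℤ.+≤+ ℕ.z≤n)
  diagonal-vector down  = ℤ.≤-refl

  diagonal-endpoint : ∀ p (w : List (Step ℓ)) → diagonal p ℤ.≤ diagonal (endpoint p w)
  diagonal-endpoint p []      = ℤ.≤-refl
  diagonal-endpoint p (u ∷ w) = begin
    diagonal p                          ≡⟨ ℤ.+-identityʳ _ ⟨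
    diagonal p ℤ.+ 0ℤ                   ≤⟨ ℤ.+-monoʳ-≤ (diagonal p) (diagonal-vector u) ⟩
    diagonal p ℤ.+ diagonal (vector u)  ≡⟨ diagonal-⊕ p (vector u) ⟨
    diagonal (p ⊕ vector u)             ≤⟨ diagonal-endpoint (p ⊕ vector u) w ⟩
    diagonal (endpoint (p ⊕ vector u) w) ∎
    where open ℤ.≤-Reasoning

  line-injective : ∀ {r r′} → line r ℤ.* + ℓ ≡ line r′ ℤ.* + ℓ → r ≡ r′
  line-injective {r} {r′} eq = ℤ.+-injective (ℤ.neg-injective (+-cancelˡ (+ n) _ _
    (≡.trans (≡.sym ([j*ℓ]/ℕℓ≡j (line r) ℓ)) (≡.trans (≡.cong (_/ℕ ℓ) eq) ([j*ℓ]/ℕℓ≡j (line r′) ℓ)))))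

  point-injective : ∀ {v v′} → point v ≡ point v′ → v ≡ v′
  point-injective {r , y} {r′ , y′} eq = ≡.cong₂ _,_
    (line-injective (≡.trans (≡.sym (diagonal-point r y)) (≡.trans (≡.cong diagonal eq) (diagonal-point r′ y′))))
    (ℤ.+-injective (≡.cong proj₂ eq))

  point-slide : ∀ r y → point (r , suc y) ⊕ vector {ℓ} down ≡ point (r , y)
  point-slide r y = ≡.cong₂ _,_ (eqx (line r ℤ.* + ℓ) (+ y)) (eqy (+ y))
    where
    eqx : ∀ u y → u ℤ.- (1ℤ ℤ.+ y) ℤ.+ 1ℤ ≡ u ℤ.- y
    eqx = ℤ-Solver.solve-∀
    eqy : ∀ y → (1ℤ ℤ.+ y) ℤ.+ (- 1ℤ) ≡ y
    eqy = ℤ-Solver.solve-∀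

  point-jump : ∀ r y i → point (suc r , y) ⊕ vector (a i) ≡ point (r , y ℕ.+ (ℓ ∸ toℕ i))
  point-jump r y i = ≡.cong₂ _,_
    (≡.trans (eqx (+ n) (+ r) (+ ℓ) (+ y) (+ toℕ i)) (≡.cong (λ z → line r ℤ.* + ℓ ℤ.- z) (≡.sym ordinate)))
    (≡.sym ordinate)
    where
    ordinate : + (y ℕ.+ (ℓ ∸ toℕ i)) ≡ + y ℤ.+ (+ ℓ ℤ.- + toℕ i)
    ordinate = ≡.cong (λ z → + y ℤ.+ z) (+[m∸n] (Fin.toℕ≤pred[n] i))
    eqx : ∀ n r l y i → (n ℤ.- (1ℤ ℤ.+ r)) ℤ.* l ℤ.- y ℤ.+ i ≡ (n ℤ.- r) ℤ.* l ℤ.- (y ℤ.+ (l ℤ.- i))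
    eqx = ℤ-Solver.solve-∀

  point-target : ∀ r k → r ℕ.+ suc (toℕ k) ≡ n → point (r , 0) ≡ target ℓ n k
  point-target r k eq = ≡.cong (_, 0ℤ) (≡.trans (ℤ.+-identityʳ _)
    (≡.trans (≡.cong (ℤ._* + ℓ) (≡.trans (≡.cong (λ m → + m ℤ.- + r) (≡.sym eq)) (cancel (+ r) (+ suc (toℕ k)))))
             (≡.sym (ℤ.pos-* (suc (toℕ k)) ℓ))))
    where
    cancel : ∀ r k → r ℤ.+ k ℤ.- r ≡ k
    cancel = ℤ-Solver.solve-∀

  run⇒endpoint : ∀ {v w k} → Run (active v) w k → endpoint (point v) w ≡ target ℓ n k
  run⇒endpoint (halt {r} {k} eq)         = point-target r k eq
  run⇒endpoint (slide {r} {y} {w} ρ)     =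
    ≡.trans (≡.cong (λ p → endpoint p w) (point-slide r y)) (run⇒endpoint ρ)
  run⇒endpoint (jump {r} {y} {i} {w} ρ)  =
    ≡.trans (≡.cong (λ p → endpoint p w) (point-jump r y i)) (run⇒endpoint ρ)

  run⇒vertices : ∀ {v w k} → Run (active v) w k → verticesFrom (point v) w ≡ List.map point (trail v w)
  run⇒vertices (halt eq)                = ≡.refl
  run⇒vertices (slide {r} {y} {w} ρ)    = ≡.cong (_ ∷_)
    (≡.trans (≡.cong (λ p → verticesFrom p w) (point-slide r y)) (run⇒vertices ρ))
  run⇒vertices (jump {r} {y} {i} {w} ρ) = ≡.cong (_ ∷_)
    (≡.trans (≡.cong (λ p → verticesFrom p w) (point-jump r y i)) (run⇒vertices ρ))

  run⇒weight : ∀ {v w k} → Run (active v) w k → wordWeight (point v) w ≈ trailWeight v w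
  run⇒weight (halt eq)                = refl
  run⇒weight (slide {r} {y} {w} ρ)    = *-cong
    (reflexive (≡.cong c (≡.trans (≡.cong (_/ℕ ℓ) (diagonal-point r (suc y))) ([j*ℓ]/ℕℓ≡j (line r) ℓ))))
    (trans (reflexive (≡.cong (λ p → wordWeight p w) (point-slide r y))) (run⇒weight ρ))
  run⇒weight (jump {r} {y} {i} {w} ρ) = *-cong
    (reflexive (≡.cong (b i) (≡.trans (≡.cong (_/ℕ ℓ) (diagonal-point (suc r) y)) ([j*ℓ]/ℕℓ≡j (line (suc r)) ℓ))))
    (trans (reflexive (≡.cong (λ p → wordWeight p w) (point-jump r y i))) (run⇒weight ρ))

  AboveAxis : Point → Set
  AboveAxis (_ , y) = 0ℤ ℤ.≤ y

  above-points : ∀ vs → All AboveAxis (List.map point vs)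
  above-points []       = []
  above-points (v ∷ vs) = ℤ.+≤+ ℕ.z≤n ∷ above-points vs

  run⇒schröder : ∀ {v w k} → Run (active v) w k → IsSchröder {ℓ} (path (point v) w)
  run⇒schröder {v} {w} ρ = ≡.subst (All AboveAxis) (≡.sym (run⇒vertices ρ)) (above-points (trail v w))

  -- Two kinds of step have no counterpart in `Run`. A down step from the axis goes below it. A jump
  -- from line `n` makes x + y exceed its value at every target, and x + y never decreases
  -- afterwards.
  schröder⇒run : ∀ v w k → All AboveAxis (verticesFrom (point v) w) → endpoint (point v) w ≡ target ℓ n k →
                 Run (active v) w k
  schröder⇒run (r , y) [] k _ eq with ℤ.+-injective (≡.cong proj₂ eq)
  ... | ≡.refl = halt (≡.trans (≡.cong (ℕ._+ suc (toℕ k)) r≡) (ℕ.m∸n+n≡m (Fin.toℕ<n k)))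
    where
    r≡ : r ≡ n ∸ suc (toℕ k)
    r≡ = ≡.cong proj₁ (point-injective {r , 0} {n ∸ suc (toℕ k) , 0}
      (≡.trans eq (≡.sym (point-target (n ∸ suc (toℕ k)) k (ℕ.m∸n+n≡m (Fin.toℕ<n k))))))
  schröder⇒run (r , zero) (down ∷ w) k (_ ∷ above) eq = contradiction (start w above) λ ()
    where
    start : ∀ {p} w → All AboveAxis (verticesFrom {ℓ} p w) → AboveAxis p
    start []      (h ∷ _) = h
    start (u ∷ w) (h ∷ _) = h
  schröder⇒run (r , suc y) (down ∷ w) k (_ ∷ above) eq = slide (schröder⇒run (r , y) w k
    (≡.subst (λ p → All AboveAxis (verticesFrom p w)) (point-slide r y) above)
    (≡.trans (≡.cong (λ p → endpoint p w) (≡.sym (point-slide r y))) eq))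
  schröder⇒run (zero , y) (a i ∷ w) k (_ ∷ above) eq = contradiction tooFar (ℕ.<⇒≱ (ℕ.m<m+n (n ℕ.* ℓ) (ℕ.>-nonZero⁻¹ ℓ)))
    where
    start≡ : diagonal (point (0 , y) ⊕ vector (a i)) ≡ + (n ℕ.* ℓ ℕ.+ ℓ)
    start≡ = ≡.trans (diagonal-⊕ (point (0 , y)) (vector (a i))) (≡.cong₂ ℤ._+_
      (≡.trans (diagonal-point 0 y) (≡.trans (≡.cong (ℤ._* + ℓ) (ℤ.+-identityʳ (+ n))) (≡.sym (ℤ.pos-* n ℓ))))
      (diagonal-a i))
    end≡ : diagonal (endpoint (point (0 , y) ⊕ vector (a i)) w) ≡ + (suc (toℕ k) ℕ.* ℓ)
    end≡ = ≡.trans (≡.cong diagonal eq) (ℤ.+-identityʳ _)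
    tooFar : n ℕ.* ℓ ℕ.+ ℓ ℕ.≤ n ℕ.* ℓ
    tooFar = ℕ.≤-trans
      (ℤ.drop‿+≤+ (≡.subst₂ ℤ._≤_ start≡ end≡ (diagonal-endpoint (point (0 , y) ⊕ vector (a i)) w)))
      (ℕ.*-monoˡ-≤ ℓ (Fin.toℕ<n k))
  schröder⇒run (suc r , y) (a i ∷ w) k (_ ∷ above) eq = jump (schröder⇒run (r , y ℕ.+ (ℓ ∸ toℕ i)) w k
    (≡.subst (λ p → All AboveAxis (verticesFrom p w)) (point-jump r y i) above)
    (≡.trans (≡.cong (λ p → endpoint p w) (≡.sym (point-jump r y i))) eq))

  source-point : ∀ (i : Fin n) → source ℓ n i ≡ point (sourceVertex (toℕ i))
  source-point i = ≡.cong (_, + (toℕ i % ℓ)) (≡.sym (begin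
    (+ n ℤ.- + (q ℕ.+ n)) ℤ.* + ℓ ℤ.- + ρ  ≡⟨ eq (+ n) (+ q) (+ ℓ) (+ ρ) ⟩
    - (+ ρ ℤ.+ + q ℤ.* + ℓ)                ≡⟨ ≡.cong (λ z → - (+ ρ ℤ.+ z)) (ℤ.pos-* q ℓ) ⟨
    - + (ρ ℕ.+ q ℕ.* ℓ)                    ≡⟨ ≡.cong (λ m → - + m) (m≡m%n+[m/n]*n (toℕ i) ℓ) ⟨
    - + toℕ i                              ∎))
    where
    open ≡.≡-Reasoning
    q ρ : ℕ
    q = toℕ i / ℓ
    ρ = toℕ i % ℓ
    eq : ∀ n q l ρ → (n ℤ.- (q ℤ.+ n)) ℤ.* l ℤ.- ρ ≡ - (ρ ℤ.+ q ℤ.* l)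
    eq = ℤ-Solver.solve-∀

  sources : Vec State n
  sources = tabulate λ i → active (sourceVertex (toℕ i))

  lookup-sources : ∀ i → lookup sources i ≡ active (sourceVertex (toℕ i))
  lookup-sources = Vec.lookup∘tabulate λ i → active (sourceVertex (toℕ i))

  pathFrom : Fin n → Word → Path ℓ
  pathFrom i w = path (point (sourceVertex (toℕ i))) w

  toSystem : Configuration → PathSystem ℓ n
  toSystem (ws , σ) = system (tabulate λ i → pathFrom i (lookup ws i)) σ

  lookup-toSystem : ∀ ws σ i → PathSystem.ω (toSystem (ws , σ)) i ≡ pathFrom i (lookup ws i)
  lookup-toSystem ws σ = Vec.lookup∘tabulate λ i → pathFrom i (lookup ws i)

  toSystem-injective : ∀ {x y} → toSystem x ≡ toSystem y → x ≡ y
  toSystem-injective {ws , σ} {ws′ , σ′} eq = ≡.cong₂ _,_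
    (Pointwise-≡⇒≡ (ext λ i → ≡.cong word (≡.trans (≡.sym (lookup-toSystem ws σ i))
      (≡.trans (≡.cong (λ Ω → PathSystem.ω Ω i) eq) (lookup-toSystem ws′ σ′ i)))))
    (≡.cong perm eq)

  source-run : ∀ {ws σ} → Valid sources (ws , σ) → ∀ i →
               Run (active (sourceVertex (toℕ i))) (lookup ws i) (lookup σ i)
  source-run {ws} {σ} V i = ≡.subst (λ s → Run s (lookup ws i) (lookup σ i)) (lookup-sources i) (Valid.run V i)

  valid⇒∈Π : ∀ x → Valid sources x → _∈Π ℓ n (toSystem x)
  valid⇒∈Π x@(ws , σ) V@(valid run inj disj) = ((inj _ _ , surjective) , ends) , schröder , nonIntersecting
    where
    Ω = toSystem x
    ω≡ = lookup-toSystem ws σ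

    surjective : ∀ v → ∃[ i ] (∀ {j} → j ≡ i → lookup σ j ≡ v)
    surjective v with injective⇒covering (lookup σ) inj v
    ... | i , σᵢ≡v = i , λ { ≡.refl → σᵢ≡v }

    ends : ∀ i → initial (PathSystem.ω Ω i) ≡ source ℓ n i × final (PathSystem.ω Ω i) ≡ target ℓ n (lookup σ i)
    ends i = ≡.trans (≡.cong initial (ω≡ i)) (≡.sym (source-point i)) ,
             ≡.trans (≡.cong final (ω≡ i)) (run⇒endpoint (source-run V i))

    schröder : ∀ i → IsSchröder (PathSystem.ω Ω i)
    schröder i = ≡.subst IsSchröder (≡.sym (ω≡ i)) (run⇒schröder (source-run V i))

    vertices≡ : ∀ i → vertices (PathSystem.ω Ω i) ≡ List.map point (trace (lookup sources i) (lookup ws i))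
    vertices≡ i = ≡.trans (≡.cong vertices (ω≡ i)) (≡.trans (run⇒vertices (source-run V i))
      (≡.cong (λ s → List.map point (trace s (lookup ws i))) (≡.sym (lookup-sources i))))

    nonIntersecting : NonIntersecting Ω
    nonIntersecting i j i≢j (p∈i , p∈j)
      with ∈-map⁻ point (≡.subst (_ ∈_) (vertices≡ i) p∈i) | ∈-map⁻ point (≡.subst (_ ∈_) (vertices≡ j) p∈j)
    ... | v , v∈i , p≡v | v′ , v′∈j , p≡v′ =
      disj i j i≢j (v∈i , ≡.subst (_∈ _) (point-injective (≡.trans (≡.sym p≡v′) p≡v)) v′∈j)

  ∈Π⇒valid : ∀ Ω → _∈Π ℓ n Ω → ∃[ x ] Valid sources x × toSystem x ≡ Ω
  ∈Π⇒valid Ω@(system ps σ) (((inj , _) , ends) , schröder , disj) =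
    (ws , σ) , valid run (λ _ _ → inj) disjoint , ≡.cong (λ ps → system ps σ) (Pointwise-≡⇒≡ (ext system≡))
    where
    ws : Vec Word n
    ws = map word ps

    ω≡ : ∀ i → lookup ps i ≡ pathFrom i (lookup ws i)
    ω≡ i = ≡.cong₂ path (≡.trans (proj₁ (ends i)) (source-point i)) (≡.sym (Vec.lookup-map i word ps))

    system≡ : ∀ i → PathSystem.ω (toSystem (ws , σ)) i ≡ lookup ps i
    system≡ i = ≡.trans (lookup-toSystem ws σ i) (≡.sym (ω≡ i))

    sourceRun : ∀ i → Run (active (sourceVertex (toℕ i))) (lookup ws i) (lookup σ i)
    sourceRun i = schröder⇒run _ (lookup ws i) (lookup σ i) (≡.subst IsSchröder (ω≡ i) (schröder i))
      (≡.trans (≡.cong final (≡.sym (ω≡ i))) (proj₂ (ends i)))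

    run : ∀ i → Run (lookup sources i) (lookup ws i) (lookup σ i)
    run i = ≡.subst (λ s → Run s (lookup ws i) (lookup σ i)) (≡.sym (lookup-sources i)) (sourceRun i)

    disjoint : ∀ i j → i ≢ j → Disjoint (trace (lookup sources i) (lookup ws i)) (trace (lookup sources j) (lookup ws j))
    disjoint i j i≢j (v∈i , v∈j) = disj i j i≢j (vertex i v∈i , vertex j v∈j)
      where
      vertex : ∀ i {v} → v ∈ trace (lookup sources i) (lookup ws i) → point v ∈ vertices (lookup ps i)
      vertex i v∈ = ≡.subst (_ ∈_)
        (≡.sym (≡.trans (≡.cong vertices (ω≡ i)) (run⇒vertices (sourceRun i))))
        (∈-map⁺ point (≡.subst (λ s → _ ∈ trace s (lookup ws i)) (lookup-sources i) v∈))

  systemWeight-toSystem : ∀ x → Valid sources x → systemWeight (toSystem x) ≈ 1# * weight sources x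
  systemWeight-toSystem (ws , σ) V = trans (*-congˡ (product-cong λ i →
      trans (reflexive (≡.cong pathWeight (lookup-toSystem ws σ i)))
            (trans (run⇒weight (source-run V i))
                   (reflexive (≡.cong (λ s → traceWeight s (lookup ws i)) (≡.sym (lookup-sources i)))))))
    (sym (*-identityˡ _))

  -- Two sums over the same set of path systems are compared: one over the list `Π`, the other over
  -- the images under `toSystem` of the configurations summed by `lgv`.
  v≈det : v[Π n ] ≈ det n 0 (rowsFrom sourceRow 0 n)
  v≈det = trans (hasSum-unique Π-sum (hasSum-resp
      (λ Ω → mk⇔ (λ { (x , V , ≡.refl) → valid⇒∈Π x V }) (∈Π⇒valid Ω)) (*-identityˡ _)
      (hasSum-image 1# toSystem-injective (λ {x} → systemWeight-toSystem x) (lgv sources))))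
    (reflexive (≡.cong (det n 0) (≡.trans (≡.sym (Vec.tabulate-∘ row (λ i → active (sourceVertex (toℕ i)))))
      (≡.sym (rowsFrom-tabulate sourceRow 0 n)))))
    where
    Π-sum : HasSum (_∈Π ℓ n) systemWeight v[Π n ]
    Π-sum = hasSum (Π ℓ n) (proj₁ (proj₂ (Π-finite ℓ n))) (proj₂ (proj₂ (Π-finite ℓ n))) refl

theorem4p10 : ∀ {r e} (R : CommutativeRing r e) (ℓ : ℕ) .{{_ : NonZero ℓ}}
    (b : Fin (suc ℓ) → ℤ → CommutativeRing.Carrier R)
    (c : ℤ → CommutativeRing.Carrier R)
    (n : ℕ) →
    let open RingNotation R
        open Weight R ℓ b c
    in v[Π n ] ≈ (∏[ i ∈ 2 ⋯ n ] (c (+ i) ^ (i ∸ 1) * (∏[ j ∈ 1 ⋯ (i ∸ 1) / ℓ ] b zero (- (+ j)))))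
               * (∏[ s ∈ 1 ⋯ n ] (∏[ t ∈ 0 ⋯ s ∸ 1 ] (∑[ i ≤ ℓ ] (b i (+ t) * c (+ s) ^ (ℓ ∸ toℕ i)))))
theorem4p10 R ℓ b c n = begin
  v[Π n ]                                          ≈⟨ v≈det ⟩
  det n 0 (rowsFrom sourceRow 0 n)                 ≈⟨ det-sources ⟩
  productFrom (λ k → climbWeight (k / ℓ)) 0 n *
  productFrom (λ k → productFrom (λ t → jumpPolynomial (+ t) (c (+ suc k))) 0 (suc k) * c (+ suc k) ^ k) 0 n
    ≈⟨ productFrom-* _ _ 0 n ⟩
  productFrom (λ k → climbWeight (k / ℓ) *
    (productFrom (λ t → jumpPolynomial (+ t) (c (+ suc k))) 0 (suc k) * c (+ suc k) ^ k)) 0 n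
    ≈⟨ productFrom-cong 0 n (λ k _ _ → factor≈ k) ⟩
  productFrom (λ k → X (suc k) * Y (suc k)) 0 n    ≡⟨ productFrom-suc (λ i → X i * Y i) 0 n ⟨
  productFrom (λ i → X i * Y i) 1 n                ≈⟨ productFrom-* X Y 1 n ⟨
  productFrom X 1 n * productFrom Y 1 n            ≈⟨ *-congʳ (dropFirst n) ⟩
  productFrom X 2 (n ∸ 1) * productFrom Y 1 n      ≡⟨ ≡.cong₂ _*_ (product-productFrom X 2 (n ∸ 1)) (product-productFrom Y 1 n) ⟨
  (∏[ i ∈ 2 ⋯ n ] X i) * (∏[ s ∈ 1 ⋯ n ] Y s)      ∎
  where
  open RingNotation R using (_^_; ∏; ∑)
  open Weight R ℓ b c
  open CommutativeRing R hiding (zero; -_)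
  open import Algebra.Properties.CommutativeSemigroup *-commutativeSemigroup using (x∙yz≈zx∙y)
  open import Relation.Binary.Reasoning.Setoid setoid
  open Determinant R
  open Evaluation R ℓ b c n
  open Translation R ℓ b c n

  X Y : ℕ → Carrier
  X i = c (+ i) ^ (i ∸ 1) * (∏[ j ∈ 1 ⋯ (i ∸ 1) / ℓ ] b zero (- (+ j)))
  Y s = ∏[ t ∈ 0 ⋯ s ∸ 1 ] (∑[ i ≤ ℓ ] (b i (+ t) * c (+ s) ^ (ℓ ∸ toℕ i)))

  factor≈ : ∀ k → climbWeight (k / ℓ) *
    (productFrom (λ t → jumpPolynomial (+ t) (c (+ suc k))) 0 (suc k) * c (+ suc k) ^ k) ≈ X (suc k) * Y (suc k)
  factor≈ k = trans (x∙yz≈zx∙y _ _ _) (*-cong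
    (*-congˡ (reflexive (≡.sym (product-productFrom (λ j → b zero (- (+ j))) 1 (k / ℓ)))))
    (reflexive (≡.sym (product-productFrom (λ t → jumpPolynomial (+ t) (c (+ suc k))) 0 (suc k)))))

  -- The product in the formula starts at i = 2, whereas the rows also supply i = 1. That factor is
  -- c_1^0 times an empty product, as 0 / ℓ = 0.
  dropFirst : ∀ n → productFrom X 1 n ≈ productFrom X 2 (n ∸ 1)
  dropFirst zero    = refl
  dropFirst (suc n) = trans (*-congʳ X₁≈1) (*-identityˡ _)
    where
    X₁≈1 : X 1 ≈ 1#
    X₁≈1 = trans (*-identityˡ _) (reflexive (≡.cong (λ d → ∏[ j ∈ 1 ⋯ d ] b zero (- (+ j))) (0/n≡0 ℓ)))
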